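{- Let $n\ge2$ and let $\pi,\sigma\in\mathfrak{B}_n$ be selected independently and uniformly at random. Let $p_{n,2}=\mathbb{P}(\pi\text{ and }\sigma\text{ are comparable})$ and $p_{n,2,\le}=\mathbb{P}(\pi\le\sigma)$, with respect to Bruhat order. Then $$p_{n,2}=\frac15+\frac{6}{5n}+\sum_{k\ge1}\left(\frac{12}{5n^{2k}}-\frac{18}{5n^{2k+1}}\right)\quad\text{and}\quad p_{n,2,\le}=\frac1{10}+\frac{3}{5n}+\sum_{k\ge2}\frac{6}{5n^k}.$$ Thus $p_{n,2}\downarrow\frac15$ and $p_{n,2,\le}\downarrow\frac1{10}$ as $n\to\infty$ (i.e. each sequence decreases with $n$ to the stated limit).
   Context: $\mathfrak{S}_n$ is the set of permutations of $[n]=\{1,\dots,n\}$, in one-line notation. A reduction of $\omega\in\mathfrak{S}_n$ interchanges $\omega(i)$ and $\omega(j)$ for some $i<j$ with $\omega(i)>\omega(j)$. Bruhat order: $\pi\le\sigma$ if $\pi$ is obtained from $\sigma$ by a (possibly empty) sequence of reductions. $\mathfrak{B}_n\subseteq\mathfrak{S}_n$ is the set of bigrassmannian permutations, i.e. those $\omega$ such that both $\omega$ and $\omega^{ -1}$ have exactly one descent; equivalently $\omega=1\cdots a\,(b+1)\cdots c\,(a+1)\cdots b\,(c+1)\cdots n$ for some $0\le a<b<c\le n$. $\pi,\sigma$ are comparable if $\pi\le\sigma$ or $\sigma\le\pi$. -}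

module Defs where

open import Data.Fin.Base as Fin using (Fin; zero; suc; toℕ; punchIn)
import Data.Fin.Properties as Fin
open import Data.Fin.Induction using (<-wellFounded)
open import Data.Fin.Permutation
  using (Permutation′; _⟨$⟩ʳ_; _≈_; flip; transpose; _∘ₚ_; insert; remove; id)
import Data.Fin.Permutation as Perm
import Data.Fin.Permutation.Components as PC
open import Data.Integer.Base using (+_)
open import Data.List.Base
  using (List; []; _∷_; length; filter; allFin; cartesianProduct; cartesianProductWith)
import Data.List.Membership.Propositional.Properties as ∈
import Data.List.Membership.Setoid as Membership
import Data.List.Membership.Setoid.Properties as ∈ₛ
import Data.List.Relation.Unary.All as All
import Data.List.Relation.Unary.AllPairs as AllPairs
open import Data.List.Relation.Unary.Any using (here)
open import Data.List.Relation.Unary.Enumerates.Setoid using (IsEnumeration)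
import Data.List.Relation.Unary.Unique.Propositional.Properties as Unique
open import Data.List.Relation.Unary.Unique.Setoid using (Unique)
import Data.List.Relation.Unary.Unique.Setoid.Properties as Uniqueₛ
open import Data.Nat.Base as ℕ using (ℕ; zero; suc; NonZero; NonTrivial)
import Data.Nat.Properties as ℕ
open import Data.Product using (∃; ∃!; _×_; _,_; proj₁; proj₂)
open import Data.Rational.Base using (ℚ; 0ℚ; _/_; _+_; _-_; _<_; ∣_∣)
open import Data.Sum.Base using (_⊎_; inj₁; inj₂)
open import Data.Vec.Base using (tabulate)
import Data.Vec.Relation.Binary.Lex.Strict as Lex
open import Function.Base using (_on_)
open import Induction.WellFounded using (Acc; acc; WellFounded)
open import Level using (0ℓ)
open import Relation.Binary.Bundles using (Setoid)
open import Relation.Binary.Construct.Closure.ReflexiveTransitive using (Star; ε; _◅_)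
import Relation.Binary.Construct.On as On
open import Relation.Binary.PropositionalEquality
  using (_≡_; refl; sym; trans; cong; subst; subst₂; setoid; resp₂)
open import Relation.Nullary.Decidable using (Dec; yes; no; map′; _×-dec_; _⊎-dec_; _→-dec_; dec-true; dec-false)
open import Relation.Unary using (Pred; Decidable)

private
  variable
    n : ℕ

------------------------------------------------------------------------
-- Permutations
--
-- 𝔖ₙ is Permutation′ n, with Fin n playing the role of {1,…,n} and
-- π ⟨$⟩ʳ i the i-th entry of the one-line notation of π.  Two elements
-- of 𝔖ₙ are identified when they agree pointwise (_≈_).

≈-setoid : ℕ → Setoid 0ℓ 0ℓ
≈-setoid n = record
  { Carrier       = Permutation′ n
  ; _≈_           = _≈_
  ; isEquivalence = record
    { refl  = λ _ → refl
    ; sym   = λ p i → sym (p i)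
    ; trans = λ p q i → trans (p i) (q i)
    }
  }

-- Each permutation of Fin (suc n) is determined by its first entry and
-- the relative order of the remaining ones.
permutations : ∀ n → List (Permutation′ n)
permutations zero    = id ∷ []
permutations (suc n) =
  cartesianProductWith (insert zero) (allFin (suc n)) (permutations n)

private
  insert-cong : ∀ {j k} {π σ : Permutation′ n} → j ≡ k → π ≈ σ →
                insert zero j π ≈ insert zero k σ
  insert-cong         refl p zero    = refl
  insert-cong {j = j} refl p (suc i) = cong (punchIn j) (p i)

  insert-injective : ∀ {j k} {π σ : Permutation′ n} →
                     insert zero j π ≈ insert zero k σ → j ≡ k × π ≈ σ
  insert-injective {j = j} p with refl ← p zero =
    refl , λ i → Fin.punchIn-injective j _ _ (p (suc i))

permutations-complete : ∀ n → IsEnumeration (≈-setoid n) (permutations n)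
permutations-complete zero    π = here λ ()
permutations-complete (suc n) π =
  ∈ₛ.∈-resp-≈ (≈-setoid (suc n))
    {x = insert zero (π ⟨$⟩ʳ zero) (remove zero π)} {π} (Perm.insert-remove zero π)
    (∈ₛ.∈-cartesianProductWith⁺ (setoid (Fin (suc n))) (≈-setoid n) (≈-setoid (suc n))
      {f = insert zero} (λ {_} {_} {π} {σ} → insert-cong {π = π} {σ})
      {b = remove zero π}
      (∈.∈-allFin (π ⟨$⟩ʳ zero)) (permutations-complete n (remove zero π)))

permutations-unique : ∀ n → Unique (≈-setoid n) (permutations n)
permutations-unique zero    = All.[] AllPairs.∷ AllPairs.[]
permutations-unique (suc n) =
  Uniqueₛ.cartesianProductWith⁺ (setoid (Fin (suc n))) (≈-setoid n) (≈-setoid (suc n))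
    (insert zero) (λ {_} {_} {π} {σ} → insert-injective {π = π} {σ})
    (Unique.allFin⁺ (suc n)) (permutations-unique n)

------------------------------------------------------------------------
-- Bruhat order

infix 4 _⟶_ _≤ᴮ_ _≤ᴮ?_

-- Precomposition with a transposition (_∘ₚ_ applies its left argument
-- first) interchanges the entries at positions i and j.
data _⟶_ (ω : Permutation′ n) : Permutation′ n → Set where
  reduce : ∀ {i j} → i Fin.< j → ω ⟨$⟩ʳ j Fin.< ω ⟨$⟩ʳ i →
           ω ⟶ transpose i j ∘ₚ ω

_≤ᴮ_ : Permutation′ n → Permutation′ n → Set
π ≤ᴮ σ = ∃ λ ρ → Star _⟶_ σ ρ × ρ ≈ π

Comparable : Permutation′ n → Permutation′ n → Set
Comparable π σ = π ≤ᴮ σ ⊎ σ ≤ᴮ π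

-- The order is decided by well-founded search: a reduction makes the
-- one-line notation lexicographically smaller.
private
  _≺_ : Permutation′ n → Permutation′ n → Set
  _≺_ = Lex.Lex-< _≡_ Fin._<_ on (λ π → tabulate (π ⟨$⟩ʳ_))

  ≺-wellFounded : WellFounded (_≺_ {n})
  ≺-wellFounded = On.wellFounded _
    (Lex.<-wellFounded trans (proj₁ (resp₂ Fin._<_)) <-wellFounded)

  lex : ∀ {m k} (f g : Fin m → Fin k) (i : Fin m) → f i Fin.< g i →
        (∀ l → l Fin.< i → f l ≡ g l) →
        Lex.Lex-< _≡_ Fin._<_ (tabulate f) (tabulate g)
  lex f g zero    lt eq = Lex.this lt refl
  lex f g (suc i) lt eq = Lex.next (eq zero (ℕ.s≤s ℕ.z≤n))
    (lex (λ l → f (suc l)) (λ l → g (suc l)) i lt λ l l<i → eq (suc l) (ℕ.s≤s l<i))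

  ⟶⇒≺ : ∀ {σ : Permutation′ n} {i j} → i Fin.< j → σ ⟨$⟩ʳ j Fin.< σ ⟨$⟩ʳ i →
         (transpose i j ∘ₚ σ) ≺ σ
  ⟶⇒≺ {σ = σ} {i} {j} i<j σj<σi = lex _ _ i
    (subst (λ k → σ ⟨$⟩ʳ k Fin.< σ ⟨$⟩ʳ i) (sym at-i) σj<σi)
    (λ l l<i → cong (σ ⟨$⟩ʳ_) (below l l<i))
    where
    at-i : PC.transpose i j i ≡ j
    at-i rewrite dec-true (i Fin.≟ i) refl = refl

    below : ∀ l → l Fin.< i → PC.transpose i j l ≡ l
    below l l<i
      rewrite dec-false (l Fin.≟ i) (Fin.<⇒≢ l<i)
            | dec-false (l Fin.≟ j) (Fin.<⇒≢ (Fin.<-trans l<i i<j)) = refl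

  search : (π σ : Permutation′ n) → Acc _≺_ σ → Dec (π ≤ᴮ σ)
  search {n} π σ (acc rec) =
    map′ to from (Fin.all? (λ i → σ ⟨$⟩ʳ i Fin.≟ π ⟨$⟩ʳ i)
                  ⊎-dec Fin.any? λ i → Fin.any? λ j → step? i j)
    where
    Step : Fin n → Fin n → Set
    Step i j = i Fin.< j × σ ⟨$⟩ʳ j Fin.< σ ⟨$⟩ʳ i × π ≤ᴮ (transpose i j ∘ₚ σ)

    step? : ∀ i j → Dec (Step i j)
    step? i j with i Fin.<? j | (σ ⟨$⟩ʳ j) Fin.<? (σ ⟨$⟩ʳ i)
    ... | no ≮   | _      = no λ s → ≮ (proj₁ s)
    ... | yes _  | no ≮   = no λ s → ≮ (proj₁ (proj₂ s))
    ... | yes lt | yes gt =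
      map′ (λ le → lt , gt , le) (λ s → proj₂ (proj₂ s))
        (search π (transpose i j ∘ₚ σ) (rec (⟶⇒≺ {σ = σ} lt gt)))

    to : σ ≈ π ⊎ (∃ λ i → ∃ (Step i)) → π ≤ᴮ σ
    to (inj₁ eq)                                     = σ , ε , eq
    to (inj₂ (i , j , lt , gt , ρ , steps , eq)) = ρ , reduce lt gt ◅ steps , eq

    from : π ≤ᴮ σ → σ ≈ π ⊎ (∃ λ i → ∃ (Step i))
    from (_ , ε , eq)                       = inj₁ eq
    from (ρ , reduce lt gt ◅ steps , eq) = inj₂ (_ , _ , lt , gt , ρ , steps , eq)

_≤ᴮ?_ : (π σ : Permutation′ n) → Dec (π ≤ᴮ σ)
π ≤ᴮ? σ = search π σ (≺-wellFounded σ)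

comparable? : (π σ : Permutation′ n) → Dec (Comparable π σ)
comparable? π σ = π ≤ᴮ? σ ⊎-dec σ ≤ᴮ? π

------------------------------------------------------------------------
-- Bigrassmannian permutations

Descent : Permutation′ n → Fin n → Set
Descent ω i = ∃ λ j → toℕ j ≡ suc (toℕ i) × ω ⟨$⟩ʳ j Fin.< ω ⟨$⟩ʳ i

Bigrassmannian : Permutation′ n → Set
Bigrassmannian ω = ∃! _≡_ (Descent ω) × ∃! _≡_ (Descent (flip ω))

private
  descent? : (ω : Permutation′ n) → Decidable (Descent ω)
  descent? ω i = Fin.any? λ j →
    (toℕ j ℕ.≟ suc (toℕ i)) ×-dec (ω ⟨$⟩ʳ j Fin.<? ω ⟨$⟩ʳ i)

  ∃!? : {P : Pred (Fin n) 0ℓ} → Decidable P → Dec (∃! _≡_ P)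
  ∃!? P? = map′ (λ (i , p , u) → i , p , λ {j} → u j) (λ (i , p , u) → i , p , λ j → u {j})
    (Fin.any? λ i → P? i ×-dec Fin.all? λ j → P? j →-dec i Fin.≟ j)

  Descent-resp : {π σ : Permutation′ n} → π ≈ σ → ∀ {i} → Descent π i → Descent σ i
  Descent-resp eq (j , next , lt) = j , next , subst₂ Fin._<_ (eq j) (eq _) lt

  flip-cong : {π σ : Permutation′ n} → π ≈ σ → flip π ≈ flip σ
  flip-cong {π = π} {σ} eq i = trans
    (sym (Perm.inverseˡ σ))
    (cong (flip σ ⟨$⟩ʳ_) (trans (sym (eq _)) (Perm.inverseʳ π)))

  ∃!-resp : {π σ : Permutation′ n} → π ≈ σ → ∃! _≡_ (Descent π) → ∃! _≡_ (Descent σ)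
  ∃!-resp {π = π} {σ} eq (i , d , u) =
    i , Descent-resp {π = π} {σ} eq d , λ d′ → u (Descent-resp {π = σ} {π} (λ k → sym (eq k)) d′)

bigrassmannian? : Decidable (Bigrassmannian {n})
bigrassmannian? ω = ∃!? (descent? ω) ×-dec ∃!? (descent? (flip ω))

Bigrassmannian-resp : {π σ : Permutation′ n} → π ≈ σ → Bigrassmannian π → Bigrassmannian σ
Bigrassmannian-resp {π = π} {σ} eq (d , d⁻¹) =
  ∃!-resp {π = π} {σ} eq d , ∃!-resp {π = flip π} {flip σ} (flip-cong {π = π} {σ} eq) d⁻¹

𝔅 : ∀ n → List (Permutation′ n)
𝔅 n = filter bigrassmannian? (permutations n)

𝔅-unique : ∀ n → Unique (≈-setoid n) (𝔅 n)
𝔅-unique n = Uniqueₛ.filter⁺ (≈-setoid n) bigrassmannian? (permutations-unique n)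

module _ {n : ℕ} where
  open Membership (≈-setoid n) using (_∈_)

  private
    resp : ∀ {π σ : Permutation′ n} → π ≈ σ → Bigrassmannian π → Bigrassmannian σ
    resp {π} {σ} = Bigrassmannian-resp {π = π} {σ}

  𝔅-complete : ∀ {ω} → Bigrassmannian ω → ω ∈ 𝔅 n
  𝔅-complete {ω} b = ∈ₛ.∈-filter⁺ (≈-setoid n) bigrassmannian?
    (λ {π} {σ} → resp {π} {σ}) {v = ω} (permutations-complete n ω) b

  𝔅-sound : ∀ {ω} → ω ∈ 𝔅 n → Bigrassmannian ω
  𝔅-sound {ω} ω∈ = proj₂ (∈ₛ.∈-filter⁻ (≈-setoid n) bigrassmannian?
    (λ {π} {σ} → resp {π} {σ}) {v = ω} {xs = permutations n} ω∈)

------------------------------------------------------------------------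
-- Probabilities

-- Division with value 0 when the denominator is 0.  That case arises only
-- for an empty sample space, i.e. for 𝔅 n with n < 2.
_÷_ : ℕ → ℕ → ℚ
m ÷ zero  = 0ℚ
m ÷ suc n = + m / suc n

-- The probability of an event under the uniform distribution on the
-- entries of Ω.
ℙ : {A : Set} {P : Pred A 0ℓ} → List A → Decidable P → ℚ
ℙ Ω P? = length (filter P? Ω) ÷ length Ω

-- Independent uniform π, σ ∈ 𝔅ₙ: the pair is uniform on 𝔅ₙ × 𝔅ₙ.
p₂ : ℕ → ℚ
p₂ n = ℙ (cartesianProduct (𝔅 n) (𝔅 n)) λ (π , σ) → comparable? π σ

p₂,≤ : ℕ → ℚ
p₂,≤ n = ℙ (cartesianProduct (𝔅 n) (𝔅 n)) λ (π , σ) → π ≤ᴮ? σ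

------------------------------------------------------------------------
-- Limits and series
--
-- Sequences are rational and so are all the limits in question, hence it
-- is enough to quantify over rational ε.

infix 4 _⟶∞_ _↓_

_⟶∞_ : (ℕ → ℚ) → ℚ → Set
u ⟶∞ ℓ = ∀ ε → 0ℚ < ε → ∃ λ N → ∀ n → N ℕ.≤ n → ∣ u n - ℓ ∣ < ε

-- sumFrom a f K = f a + f (a + 1) + ⋯ + f (a + K - 1)
sumFrom : ℕ → (ℕ → ℚ) → ℕ → ℚ
sumFrom a f zero    = 0ℚ
sumFrom a f (suc K) = sumFrom a f K + f (a ℕ.+ K)

-- ∑_{k ≥ a} f k = s
HasSumFrom : ℕ → (ℕ → ℚ) → ℚ → Set
HasSumFrom a f s = sumFrom a f ⟶∞ s

-- Strictly decreasing on the indices n ≥ 2, with limit ℓ.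
_↓_ : (ℕ → ℚ) → ℚ → Set
u ↓ ℓ = (∀ n → .{{NonTrivial n}} → u (suc n) < u n) × u ⟶∞ ℓ

infix 8 _/5·_^_

-- a / (5 nᵏ)
_/5·_^_ : ℕ → (n : ℕ) → ℕ → .{{NonTrivial n}} → ℚ
a /5· n ^ k = + a / (5 ℕ.* n ℕ.^ k)
  where instance
    n≢0 : NonZero n
    n≢0 = ℕ.nonTrivial⇒nonZero n

    nᵏ≢0 : NonZero (n ℕ.^ k)
    nᵏ≢0 = ℕ.m^n≢0 n k

    5nᵏ≢0 : NonZero (5 ℕ.* n ℕ.^ k)
    5nᵏ≢0 = ℕ.m*n≢0 5 (n ℕ.^ k)

module Submission where

-- An element of 𝔅ₙ interchanges a block of z values with the block of the
-- w values following it, leaving a entries in front and b entries behind.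
-- For π, σ ∈ 𝔅ₙ, π ≤ σ in the Bruhat order iff a and b are at least as
-- large for π as for σ, and z and w at most as large.  Necessity: a
-- reduction never enlarges the maximal displacement to the right or to the
-- left, and it fixes the ends that were fixed before.  Sufficiency: z or w
-- can be lowered by one, in favour of a or of b, by moving a single entry
-- past a block.
--
-- Hence the pairs π ≤ σ correspond to the solutions of α + β = ζ + μ in
-- the differences of the parameters.  Splitting them according to whether
-- α ≥ ζ, they are counted by the weak compositions of n-2 and of n-3 into
-- seven parts, and |𝔅ₙ| by those of n-2 into four.  With n = m + 2 this
-- gives p₂,≤ = (m+4)(m+5) / 10(m+1)(m+2), and p₂ follows by
-- inclusion-exclusion, the order being antisymmetric on 𝔅ₙ.

-- `Bigrassmannian` speaks of descents, so the block form has to be derived. One descent in `ω` and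
-- one in its inverse cut the positions into four intervals on each of which `ω` increases, with an
-- inverse increasing on the image. Mutually inverse increasing maps of integer intervals are
-- translations, which leaves only the interchange of two adjacent blocks. Permutations are
-- continued by the identity to all of ℕ, so that the boundary of `Fin n` does not interfere.
--
-- Elements of 𝔖ₙ are identified only by `_≈_`, whereas `length` counts list entries. Cardinalities
-- are therefore compared through relations, one inequality at a time, with `Represents` linking
-- permutations and codes. Only two of the four moves on the parameters are constructed; the other
-- two follow from the invariance of the Bruhat order under inversion.
--
-- Both series have rational sums and explicit rational remainders, against which they telescope.

open import Defs
open import Data.Nat.Base as ℕ using (ℕ; zero; suc; NonTrivial)
open import Data.Product using (∃; _×_; _,_)
open import Data.Rational.Base using (_/_)
open import Relation.Binary.PropositionalEquality

-- Fractions, limits and telescoping series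

module _ where
  open import Data.Integer.Base as ℤ using (+_; +<+)
  import Data.Integer.Properties as ℤ
  open import Data.Nat.Base using (NonZero)
  import Data.Nat.Properties as ℕ
  open import Data.Nat.Tactic.RingSolver using (solve-∀)
  open import Data.Rational.Base hiding (NonZero; _÷_; _/_)
  open import Data.Rational.Properties
  open import Data.Rational.Unnormalised.Base as ℚᵘ using (mkℚᵘ; *≡*; *<*)
  import Data.Rational.Unnormalised.Properties as ℚᵘ

  /≡÷ : ∀ a b .{{_ : NonZero b}} → + a / b ≡ a ÷ b
  /≡÷ a (suc b) = refl

  ÷-≡ : ∀ a b c d .{{_ : NonZero b}} .{{_ : NonZero d}} → a ℕ.* d ≡ c ℕ.* b → a ÷ b ≡ c ÷ d
  ÷-≡ a (suc b) c (suc d) eq = fromℚᵘ-cong {mkℚᵘ (+ a) b} {mkℚᵘ (+ c) d}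
    (*≡* (trans (sym (ℤ.pos-* a (suc d))) (trans (cong +_ eq) (ℤ.pos-* c (suc b)))))

  ÷-< : ∀ a b c d .{{_ : NonZero b}} .{{_ : NonZero d}} → a ℕ.* d ℕ.< c ℕ.* b → a ÷ b < c ÷ d
  ÷-< a (suc b) c (suc d) lt = toℚᵘ-cancel-<
    (ℚᵘ.<-respˡ-≃ (ℚᵘ.≃-sym (toℚᵘ-fromℚᵘ (mkℚᵘ (+ a) b)))
      (ℚᵘ.<-respʳ-≃ (ℚᵘ.≃-sym (toℚᵘ-fromℚᵘ (mkℚᵘ (+ c) d)))
        (*<* (subst₂ ℤ._<_ (ℤ.pos-* a (suc d)) (ℤ.pos-* c (suc b)) (+<+ lt)))))

  ÷-+ : ∀ a b c d .{{_ : NonZero b}} .{{_ : NonZero d}} →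
        a ÷ b + c ÷ d ≡ (a ℕ.* d ℕ.+ c ℕ.* b) ÷ (b ℕ.* d)
  ÷-+ a (suc b) c (suc d) = toℚᵘ-injective (begin
    toℚᵘ (a ÷ suc b + c ÷ suc d)
      ≈⟨ toℚᵘ-homo-+ (a ÷ suc b) (c ÷ suc d) ⟩
    toℚᵘ (a ÷ suc b) ℚᵘ.+ toℚᵘ (c ÷ suc d)
      ≈⟨ ℚᵘ.+-cong (toℚᵘ-fromℚᵘ (mkℚᵘ (+ a) b)) (toℚᵘ-fromℚᵘ (mkℚᵘ (+ c) d)) ⟩
    mkℚᵘ (+ a) b ℚᵘ.+ mkℚᵘ (+ c) d
      ≈⟨ ℚᵘ.≃-reflexive (cong (λ x → mkℚᵘ x (d ℕ.+ b ℕ.* suc d)) numerator) ⟩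
    mkℚᵘ (+ (a ℕ.* suc d ℕ.+ c ℕ.* suc b)) (d ℕ.+ b ℕ.* suc d)
      ≈⟨ toℚᵘ-fromℚᵘ _ ⟨
    toℚᵘ ((a ℕ.* suc d ℕ.+ c ℕ.* suc b) ÷ (suc b ℕ.* suc d)) ∎)
    where
    open ℚᵘ.≃-Reasoning
    numerator : + a ℤ.* + suc d ℤ.+ + c ℤ.* + suc b ≡ + (a ℕ.* suc d ℕ.+ c ℕ.* suc b)
    numerator = trans (cong₂ ℤ._+_ (sym (ℤ.pos-* a (suc d))) (sym (ℤ.pos-* c (suc b))))
      (sym (ℤ.pos-+ (a ℕ.* suc d) (c ℕ.* suc b)))

  ÷-nonNegative : ∀ a b → NonNegative (a ÷ b)
  ÷-nonNegative a zero    = _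
  ÷-nonNegative a (suc b) = normalize-nonNeg a (suc b)

  -- Nonnegativity is included because it removes the absolute value from `_⟶∞_`; all remainders
  -- below have one sign.
  Vanishes : (ℕ → ℚ) → Set
  Vanishes r = (∀ n → NonNegative (r n)) × ∀ ε → 0ℚ < ε → ∃ λ N → ∀ n → N ℕ.≤ n → r n < ε

  -- Where `b n` is positive, the hypothesis bounds the fraction by `c / (n + 1)`; where it is 0,
  -- `_÷_` returns 0.
  ÷-vanishes : ∀ (a b : ℕ → ℕ) c → (∀ n → a n ℕ.* suc n ℕ.≤ c ℕ.* b n) → Vanishes (λ n → a n ÷ b n)
  ÷-vanishes a b c bound = (λ n → ÷-nonNegative (a n) (b n)) , small
    where
    small : ∀ ε → 0ℚ < ε → ∃ λ N → ∀ n → N ℕ.≤ n → a n ÷ b n < ε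
    small ε 0<ε with positive 0<ε
    -- Since `ε ≥ 1 / (q + 1)`, it is enough that `c (q + 1) < n + 1`.
    small (mkℚ (+ suc p) q coprime) 0<ε | _ = c ℕ.* suc q , below
      where
      below : ∀ n → c ℕ.* suc q ℕ.≤ n → a n ÷ b n < mkℚ (+ suc p) q coprime
      below n N≤n with b n | bound n
      ... | zero    | _   = 0<ε
      ... | suc b-1 | bnd = subst (a n ÷ suc b-1 <_) (↥p/↧p≡p (mkℚ (+ suc p) q coprime))
        (÷-< (a n) (suc b-1) (suc p) (suc q) (ℕ.<-≤-trans (ℕ.*-cancelʳ-< (suc n) (a n ℕ.* suc q) (suc b-1) (begin-strict
          a n ℕ.* suc q ℕ.* suc n     ≡⟨ rearrange (a n) (suc q) (suc n) ⟩
          a n ℕ.* suc n ℕ.* suc q     ≤⟨ ℕ.*-monoˡ-≤ (suc q) bnd ⟩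
          c ℕ.* suc b-1 ℕ.* suc q     ≡⟨ rearrange c (suc b-1) (suc q) ⟩
          c ℕ.* suc q ℕ.* suc b-1     ≤⟨ ℕ.*-monoˡ-≤ (suc b-1) N≤n ⟩
          n ℕ.* suc b-1               <⟨ ℕ.*-monoˡ-< (suc b-1) (ℕ.n<1+n n) ⟩
          suc n ℕ.* suc b-1           ≡⟨ ℕ.*-comm (suc n) (suc b-1) ⟩
          suc b-1 ℕ.* suc n           ∎)) (ℕ.m≤n*m (suc b-1) (suc p))))
        where
        open ℕ.≤-Reasoning
        rearrange : ∀ x y z → x ℕ.* y ℕ.* z ≡ x ℕ.* z ℕ.* y
        rearrange = solve-∀

  ⟶∞-above : ∀ k {u r ℓ} → Vanishes r → (∀ n → u (k ℕ.+ n) ≡ ℓ + r n) → u ⟶∞ ℓ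
  ⟶∞-above k {u} {r} {ℓ} (r≥0 , r→0) eq ε 0<ε with N , close ← r→0 ε 0<ε = k ℕ.+ N , close′
    where
    distance : ∀ n → ∣ u (k ℕ.+ n) - ℓ ∣ ≡ r n
    distance n = trans (cong ∣_∣ (begin
      u (k ℕ.+ n) - ℓ ≡⟨ cong (_- ℓ) (trans (eq n) (+-comm ℓ (r n))) ⟩
      r n + ℓ - ℓ     ≡⟨ +-assoc (r n) ℓ (- ℓ) ⟩
      r n + (ℓ - ℓ)   ≡⟨ cong (_+_ (r n)) (+-inverseʳ ℓ) ⟩
      r n + 0ℚ        ≡⟨ +-identityʳ (r n) ⟩
      r n             ∎)) (0≤p⇒∣p∣≡p (nonNegative⁻¹ (r n) {{r≥0 n}}))
      where open ≡-Reasoning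

    close′ : ∀ n → k ℕ.+ N ℕ.≤ n → ∣ u n - ℓ ∣ < ε
    close′ n k+N≤n with i , refl ← ℕ.m≤n⇒∃[o]m+o≡n (ℕ.m+n≤o⇒m≤o k k+N≤n) =
      subst (_< ε) (sym (distance i)) (close i (ℕ.+-cancelˡ-≤ k N i k+N≤n))

  -- `t k` is the remainder after `k` terms: the partial sum of `k` terms and `t k` always add up to
  -- `t 0`.
  telescoping : ∀ a {f t} → Vanishes t → (∀ k → f (a ℕ.+ k) + t (suc k) ≡ t k) →
    HasSumFrom a f (t 0)
  telescoping a {f} {t} (t≥0 , t→0) step ε 0<ε with N , close ← t→0 ε 0<ε =
    N , λ n N≤n → subst (_< ε) (sym (distance n)) (close n N≤n)
    where
    open ≡-Reasoning

    partial : ∀ k → sumFrom a f k + t k ≡ t 0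
    partial zero    = +-identityˡ (t 0)
    partial (suc k) = trans (+-assoc (sumFrom a f k) (f (a ℕ.+ k)) (t (suc k)))
      (trans (cong (_+_ (sumFrom a f k)) (step k)) (partial k))

    distance : ∀ k → ∣ sumFrom a f k - t 0 ∣ ≡ t k
    distance k = trans (cong ∣_∣ (begin
      S - t 0             ≡⟨ cong (λ x → S - x) (partial k) ⟨
      S - (S + t k)       ≡⟨ cong (_+_ S) (neg-distrib-+ S (t k)) ⟩
      S + (- S - t k)     ≡⟨ +-assoc S (- S) (- t k) ⟨
      S - S - t k         ≡⟨ cong (_- t k) (+-inverseʳ S) ⟩
      0ℚ - t k            ≡⟨ +-identityˡ (- t k) ⟩
      - t k               ∎)) (trans (∣-p∣≡∣p∣ (t k)) (0≤p⇒∣p∣≡p (nonNegative⁻¹ (t k) {{t≥0 k}})))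
      where S = sumFrom a f k

-- Bigrassmannian permutations and their Bruhat order

module _ where
  open import Data.Fin.Base as Fin using (Fin; toℕ; fromℕ<)
  open import Data.Fin.Permutation
    using (Permutation′; permutation; _⟨$⟩ʳ_; _⟨$⟩ˡ_; _≈_; flip; transpose; _∘ₚ_; inverseˡ; inverseʳ)
  import Data.Fin.Permutation.Components as PC
  import Data.Fin.Properties as Fin
  open import Data.Nat.Base
  open import Data.Nat.Properties
  open import Data.Nat.Tactic.RingSolver using (solve-∀)
  open import Data.Product using (∃₂; ∃!; proj₁; proj₂)
  open import Data.Sum.Base using (_⊎_; inj₁; inj₂)
  open import Data.Vec.Base using (Vec; []; _∷_; sum)
  open import Function.Base using (_∘_)
  open import Relation.Binary.Construct.Closure.ReflexiveTransitive using (Star; ε; _◅_; _◅◅_)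
  open import Relation.Binary.Definitions using (tri<; tri≈; tri>)
  open import Relation.Nullary.Decidable using (yes; no; dec-true; dec-false)
  open import Relation.Nullary.Negation using (contradiction)

  -- BlockSwap a z w i v: v is the i-th entry, counting both from 0, of
  -- the sequence obtained from 0 1 2 … by interchanging the block of the
  -- z values from a on with the block of the w values following it.
  data BlockSwap (a z w i v : ℕ) : Set where
    low  : i < a → v ≡ i → BlockSwap a z w i v
    up   : a ≤ i → i < a + w → v ≡ i + z → BlockSwap a z w i v
    down : a ≤ v → v < a + z → i ≡ v + w → BlockSwap a z w i v
    high : a + w + z ≤ i → v ≡ i → BlockSwap a z w i v

  BlockSwap-total : ∀ a z w i → ∃ (BlockSwap a z w i)
  BlockSwap-total a z w i with i <? a | i <? a + w | i <? a + w + z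
  ... | yes i<a | _       | _       = _ , low i<a refl
  ... | no i≮a  | yes i<b | _       = _ , up (≮⇒≥ i≮a) i<b refl
  ... | no _    | no i≮b  | no i≮c  = _ , high (≮⇒≥ i≮c) refl
  ... | no _    | no i≮b  | yes i<c with k , refl ← m≤n⇒∃[o]m+o≡n (≮⇒≥ i≮b) =
    a + k , down (m≤m+n a k) (+-monoʳ-< a (+-cancelˡ-< (a + w) k z i<c)) (lemma a w k)
    where
    lemma : ∀ a w k → a + w + k ≡ a + k + w
    lemma = solve-∀

  module _ {a z w : ℕ} where

    -- `up` and `down` are mirror images: each bounds the smaller of position and value and
    -- expresses the larger one as a sum. Inversion merely exchanges them.
    BlockSwap-flip : ∀ {i v} → BlockSwap a z w i v → BlockSwap a w z v i
    BlockSwap-flip (low i<a refl)   = low i<a refl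
    BlockSwap-flip (up a≤i i<b eq)  = down a≤i i<b eq
    BlockSwap-flip (down a≤v v<b eq) = up a≤v v<b eq
    BlockSwap-flip {i} (high c≤i refl) = high (subst (_≤ i) (lemma a w z) c≤i) refl
      where
      lemma : ∀ a w z → a + w + z ≡ a + z + w
      lemma = solve-∀

    private
      down≥ : ∀ {v} → a ≤ v → a + w ≤ v + w
      down≥ = +-monoˡ-≤ w

      down< : ∀ {v} → v < a + z → v + w < a + w + z
      down< {v} v<b = begin-strict
        v + w     <⟨ +-monoˡ-< w v<b ⟩
        a + z + w ≡⟨ +-assoc a z w ⟩
        a + (z + w) ≡⟨ cong (a +_) (+-comm z w) ⟩
        a + (w + z) ≡⟨ +-assoc a w z ⟨
        a + w + z ∎
        where open ≤-Reasoning

      a≤b : a ≤ a + w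
      a≤b = m≤m+n a w

      b≤c : a + w ≤ a + w + z
      b≤c = m≤m+n (a + w) z

    -- Of the sixteen cases only `up` followed by `down` is an inversion. For adjacent positions the
    -- conclusion pins down the descent.
    BlockSwap-inversion : ∀ {i j v u} → BlockSwap a z w i v → BlockSwap a z w j u →
                          i < j → u < v → i < a + w × a + w ≤ j
    BlockSwap-inversion (low i<a refl) (low _ refl) i<j u<v = contradiction u<v (<-asym i<j)
    BlockSwap-inversion (low i<a refl) (up _ _ refl) i<j u<v =
      contradiction (≤-<-trans (m≤m+n _ z) u<v) (<-asym i<j)
    BlockSwap-inversion (low i<a refl) (down a≤u _ _) i<j u<v =
      contradiction (<-trans u<v i<a) (≤⇒≯ a≤u)
    BlockSwap-inversion (low i<a refl) (high _ refl) i<j u<v = contradiction u<v (<-asym i<j)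
    BlockSwap-inversion (up a≤i _ _) (low j<a _) i<j u<v =
      contradiction (<-trans i<j j<a) (≤⇒≯ a≤i)
    BlockSwap-inversion (up _ _ refl) (up _ _ refl) i<j u<v =
      contradiction (+-cancelʳ-< z _ _ u<v) (<-asym i<j)
    BlockSwap-inversion (up _ i<b _) (down a≤u _ refl) i<j u<v = i<b , down≥ a≤u
    BlockSwap-inversion (up _ i<b refl) (high c≤j refl) i<j u<v =
      contradiction (<-trans u<v (+-monoˡ-< z i<b)) (≤⇒≯ c≤j)
    BlockSwap-inversion (down a≤v _ refl) (low j<a _) i<j u<v =
      contradiction (<-trans (≤-<-trans (m≤m+n _ w) i<j) j<a) (≤⇒≯ a≤v)
    BlockSwap-inversion (down a≤v _ refl) (up _ j<b _) i<j u<v =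
      contradiction (<-trans i<j j<b) (≤⇒≯ (down≥ a≤v))
    BlockSwap-inversion (down _ _ refl) (down _ _ refl) i<j u<v =
      contradiction (+-cancelʳ-< w _ _ i<j) (<-asym u<v)
    BlockSwap-inversion (down _ _ refl) (high _ refl) i<j u<v =
      contradiction (≤-<-trans (m≤m+n _ w) i<j) (<-asym u<v)
    BlockSwap-inversion (high c≤i refl) (low j<a _) i<j u<v =
      contradiction (<-trans i<j j<a) (≤⇒≯ (≤-trans (≤-trans a≤b b≤c) c≤i))
    BlockSwap-inversion (high c≤i refl) (up _ j<b _) i<j u<v =
      contradiction (<-trans i<j j<b) (≤⇒≯ (≤-trans b≤c c≤i))
    BlockSwap-inversion (high c≤i refl) (down _ u<b refl) i<j u<v =
      contradiction (<-trans i<j (down< u<b)) (≤⇒≯ c≤i)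
    BlockSwap-inversion (high _ refl) (high _ refl) i<j u<v = contradiction u<v (<-asym i<j)

    BlockSwap-functional : ∀ {i v u} → BlockSwap a z w i v → BlockSwap a z w i u → v ≡ u
    BlockSwap-functional (low _ refl) (low _ refl) = refl
    BlockSwap-functional (low i<a _) (up a≤i _ _) = contradiction i<a (≤⇒≯ a≤i)
    BlockSwap-functional (low i<a _) (down a≤u _ refl) =
      contradiction i<a (≤⇒≯ (≤-trans a≤u (m≤m+n _ w)))
    BlockSwap-functional (low _ refl) (high _ refl) = refl
    BlockSwap-functional (up a≤i _ _) (low i<a _) = contradiction i<a (≤⇒≯ a≤i)
    BlockSwap-functional (up _ _ refl) (up _ _ refl) = refl
    BlockSwap-functional (up _ i<b _) (down a≤u _ refl) = contradiction i<b (≤⇒≯ (down≥ a≤u))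
    BlockSwap-functional (up _ i<b _) (high c≤i _) = contradiction i<b (≤⇒≯ (≤-trans b≤c c≤i))
    BlockSwap-functional (down a≤v _ refl) (low i<a _) =
      contradiction i<a (≤⇒≯ (≤-trans a≤v (m≤m+n _ w)))
    BlockSwap-functional (down a≤v _ refl) (up _ i<b _) = contradiction i<b (≤⇒≯ (down≥ a≤v))
    BlockSwap-functional {v = v} {u} (down _ _ refl) (down _ _ eq) = +-cancelʳ-≡ w v u eq
    BlockSwap-functional (down _ v<b refl) (high c≤i _) = contradiction (down< v<b) (≤⇒≯ c≤i)
    BlockSwap-functional (high _ refl) (low _ refl) = refl
    BlockSwap-functional (high c≤i _) (up _ i<b _) = contradiction i<b (≤⇒≯ (≤-trans b≤c c≤i))
    BlockSwap-functional (high c≤i _) (down _ v<b refl) = contradiction (down< v<b) (≤⇒≯ c≤i)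
    BlockSwap-functional (high _ refl) (high _ refl) = refl

  -- Permutations with a single descent whose inverse has a single descent.

  Rising : (ℕ → ℕ) → ℕ → ℕ → Set
  Rising f p q = ∀ {i} → p ≤ i → i < q → f i < f (suc i)

  climb : ∀ {f p q i} → Rising f p q → ∀ k → p ≤ i → i + k ≤ q → f i + k ≤ f (i + k)
  climb {f} {i = i} ↑f zero    p≤i _   =
    ≤-reflexive (trans (+-identityʳ (f i)) (cong f (sym (+-identityʳ i))))
  climb {f} {i = i} ↑f (suc k) p≤i i+k≤q rewrite +-suc i k | +-suc (f i) k =
    ≤-<-trans (climb {f} ↑f k p≤i (<⇒≤ i+k≤q)) (↑f (≤-trans p≤i (m≤m+n i k)) i+k≤q)

  rising-< : ∀ {f p q i j} → Rising f p q → p ≤ i → i < j → j ≤ q → f i < f j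
  rising-< {f} {i = i} ↑f p≤i i<j j≤q with k , refl ← m≤n⇒∃[o]m+o≡n i<j =
    <-≤-trans (↑f p≤i (<-≤-trans i<j j≤q))
      (m+n≤o⇒m≤o _ (climb {f} ↑f k (m≤n⇒m≤1+n p≤i) j≤q))

  rising-≤ : ∀ {f p q i j} → Rising f p q → p ≤ i → i ≤ j → j ≤ q → f i ≤ f j
  rising-≤ {f} ↑f p≤i i≤j j≤q with k , refl ← m≤n⇒∃[o]m+o≡n i≤j =
    m+n≤o⇒m≤o _ (climb {f} ↑f k p≤i j≤q)

  module _ {f g : ℕ → ℕ} (g∘f : ∀ i → g (f i) ≡ i)
           {p q r s : ℕ} (↑f : Rising f p q) (↑g : Rising g r s) where

    -- By `climb`, the `k` steps of `f` after `i` cover a distance `l ≥ k` in the values. Climbing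
    -- along `g` over that distance gives `l ≤ k`, so no value is skipped. The translation is
    -- anchored at the left end.
    rising-from : ∀ {i v} k → p ≤ i → f i ≡ v → r ≤ v → i + k ≤ q → f (i + k) ≤ s →
                  f (i + k) ≡ v + k
    rising-from {i} k p≤i refl r≤v i+k≤q fj≤s
      with l , eq ← m≤n⇒∃[o]m+o≡n (m+n≤o⇒m≤o (f i) (climb {f} ↑f k p≤i i+k≤q)) =
      ≤-antisym (subst (_≤ f i + k) eq (+-monoʳ-≤ (f i) l≤k)) (climb {f} ↑f k p≤i i+k≤q)
      where
      l≤k : l ≤ k
      l≤k = +-cancelˡ-≤ i l k (begin
        i + l         ≡⟨ cong (_+ l) (g∘f i) ⟨
        g (f i) + l   ≤⟨ climb {g} ↑g l r≤v (subst (_≤ s) (sym eq) fj≤s) ⟩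
        g (f i + l)   ≡⟨ cong g eq ⟩
        g (f (i + k)) ≡⟨ g∘f (i + k) ⟩
        i + k         ∎)
        where open ≤-Reasoning

    -- The same squeeze, for intervals on which the value at the right end is the known one.
    rising-to : ∀ {i v} k → p ≤ i → i + k ≤ q → r ≤ f i → f (i + k) ≡ v → v ≤ s →
                f i + k ≡ v
    rising-to {i} k p≤i i+k≤q r≤fi refl v≤s
      with l , eq ← m≤n⇒∃[o]m+o≡n (m+n≤o⇒m≤o (f i) (climb {f} ↑f k p≤i i+k≤q)) =
      ≤-antisym (climb {f} ↑f k p≤i i+k≤q) (subst (_≤ f i + k) eq (+-monoʳ-≤ (f i) l≤k))
      where
      l≤k : l ≤ k
      l≤k = +-cancelˡ-≤ i l k (begin
        i + l         ≡⟨ cong (_+ l) (g∘f i) ⟨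
        g (f i) + l   ≤⟨ climb {g} ↑g l r≤fi (subst (_≤ s) (sym eq) v≤s) ⟩
        g (f i + l)   ≡⟨ cong g eq ⟩
        g (f (i + k)) ≡⟨ g∘f (i + k) ⟩
        i + k         ∎)
        where open ≤-Reasoning

  OnlyDescent : (ℕ → ℕ) → ℕ → Set
  OnlyDescent f d = f (suc d) < f d × ∀ {i} → i ≢ d → f i < f (suc i)

  module _ {f d} (↓f : OnlyDescent f d) where

    rises-before : Rising f 0 d
    rises-before _ i<d = proj₂ ↓f (<⇒≢ i<d)

    rises-after : ∀ {q} → Rising f (suc d) q
    rises-after d<i _ = proj₂ ↓f (≢-sym (<⇒≢ d<i))

    inversion-straddles : ∀ {i j} → i < j → f j < f i → i ≤ d × d < j
    inversion-straddles {i} {j} i<j fj<fi =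
      ≮⇒≥ (λ d<i → <-asym fj<fi (rising-< {f} (rises-after {j}) d<i i<j ≤-refl)) ,
      ≰⇒> (λ j≤d → <-asym fj<fi (rising-< {f} rises-before z≤n i<j j≤d))

  module _ {f g : ℕ → ℕ} (f∘g : ∀ v → f (g v) ≡ v) (g∘f : ∀ i → g (f i) ≡ i)
           {d e : ℕ} (↓f : OnlyDescent f d) (↓g : OnlyDescent g e)
           {n : ℕ} (fixed : ∀ {i} → n ≤ i → f i ≡ i) where

    private
      -- The positions of the values `e + 1` and `e`. As `g` falls at `e`, they form an inversion of
      -- `f`, so the descent `d` lies between them.
      a = g (suc e)
      b = g e

      fa≡1+e : f a ≡ suc e
      fa≡1+e = f∘g (suc e)

      fb≡e : f b ≡ e
      fb≡e = f∘g e

      d-inside : a ≤ d × d < b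
      d-inside = inversion-straddles {f} ↓f (proj₁ ↓g)
        (subst₂ _<_ (sym fb≡e) (sym fa≡1+e) (n<1+n e))

      a≤d = proj₁ d-inside
      d<b = proj₂ d-inside

      e-inside : f (suc d) ≤ e × e < f d
      e-inside = inversion-straddles {g} ↓g (proj₁ ↓f)
        (subst₂ _<_ (sym (g∘f d)) (sym (g∘f (suc d))) (n<1+n d))

      -- Values before `a` are at most `e`, so both maps rise from 0 here. A map strictly rising
      -- from 0 is nowhere below its argument: `i ≤ f i` and `f i ≤ g (f i) = i`.
      first : ∀ {i} → i < a → f i ≡ i
      first {i} i<a = ≤-antisym
        (subst (f i ≤_) (g∘f i) (m+n≤o⇒n≤o (g 0) (climb {g} (rises-before {g} ↓g) (f i) z≤n fi≤e)))
        (m+n≤o⇒n≤o (f 0) (climb {f} (rises-before {f} ↓f) i z≤n (≤-trans (<⇒≤ i<a) a≤d)))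
        where
        fi≤e : f i ≤ e
        fi≤e = s≤s⁻¹ (subst (f i <_) fa≡1+e (rising-< {f} (rises-before {f} ↓f) z≤n i<a a≤d))

      second : ∀ k → a + k ≤ d → f (a + k) ≡ suc e + k
      second k a+k≤d = rising-from {f} {g} g∘f (rises-before {f} ↓f) (rises-after {g} ↓g)
        k z≤n fa≡1+e ≤-refl a+k≤d ≤-refl

      third : ∀ {i} k → d < i → i + k ≡ b → f i + k ≡ e
      third k d<i eq = rising-to {f} {g} g∘f (rises-after {f} ↓f) (rises-before {g} ↓g)
        k d<i ≤-refl z≤n (trans (cong f eq) fb≡e) ≤-refl

      -- The anchor on the right is `i + n`, a position that is fixed because it is at least `n`.
      fourth : ∀ {i} → b < i → f i ≡ i
      fourth {i} b<i = +-cancelʳ-≡ n (f i) i (rising-to {f} {g} g∘f (rises-after {f} ↓f) (rises-after {g} ↓g)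
        n (<-trans d<b b<i) ≤-refl
        (subst (_< f i) fb≡e (rising-< {f} (rises-after {f} ↓f) d<b b<i ≤-refl))
        (fixed (m≤n+m n i)) ≤-refl)

      -- `third` is anchored at its right end, so its first value must be found separately. A value
      -- below `a` already belongs to a fixed point. A value above `a` would leave `a` without a
      -- position: before `a` there are fixed points, from `a` to `d` values above `e`, and after
      -- `d` values of at least `f (suc d)`.
      third-start : f (suc d) ≡ a
      third-start with <-cmp (f (suc d)) a
      ... | tri≈ _ eq _ = eq
      ... | tri< u<a _ _ = contradiction
        (trans (sym (g∘f (f (suc d)))) (trans (cong g (first u<a)) (g∘f (suc d))))
        (<⇒≢ (<-≤-trans u<a (≤-trans a≤d (n≤1+n d))))
      ... | tri> _ _ a<u with g a <? a
      ...   | yes ga<a = contradiction (trans (sym (first ga<a)) (f∘g a)) (<⇒≢ ga<a)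
      ...   | no ga≮a = contradiction (begin-strict
        e         <⟨ n<1+n e ⟩
        suc e     ≡⟨ fa≡1+e ⟨
        f a       ≤⟨ rising-≤ {f} (rises-before {f} ↓f) z≤n (≮⇒≥ ga≮a) ga≤d ⟩
        f (g a)   ≡⟨ f∘g a ⟩
        a         ≤⟨ <⇒≤ a<u ⟩
        f (suc d) ≤⟨ proj₁ e-inside ⟩
        e         ∎) (<-irrefl refl)
        where
        open ≤-Reasoning
        ga≤d : g a ≤ d
        ga≤d = s≤s⁻¹ (subst (g a <_) (g∘f (suc d))
          (rising-< {g} (rises-before {g} ↓g) z≤n a<u (proj₁ e-inside)))

    -- The four constructors belong to the intervals `[0, a)`, `[a, d]`, `[d + 1, b]` and `(b, ∞)`.
    -- The middle two have lengths `suc w` and `suc z`, since they contain `d` and `b` respectively.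
    classify : ∃ λ a → ∃ λ z → ∃ λ w → ∀ i → BlockSwap a (suc z) (suc w) i (f i)
    classify with w , a+w≡d ← m≤n⇒∃[o]m+o≡n a≤d | z , 1+d+z≡b ← m≤n⇒∃[o]m+o≡n d<b = a , z , w , shape
      where
      a+z≡e : a + z ≡ e
      a+z≡e = trans (cong (_+ z) (sym third-start)) (third z ≤-refl 1+d+z≡b)

      c≡1+b : a + suc w + suc z ≡ suc b
      c≡1+b = begin
        a + suc w + suc z   ≡⟨ cong (_+ suc z) (+-suc a w) ⟩
        suc (a + w) + suc z ≡⟨ +-suc (suc (a + w)) z ⟩
        suc (suc (a + w) + z) ≡⟨ cong (λ x → suc (suc x + z)) a+w≡d ⟩
        suc (suc d + z)     ≡⟨ cong suc 1+d+z≡b ⟩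
        suc b ∎
        where open ≡-Reasoning

      shape : ∀ i → BlockSwap a (suc z) (suc w) i (f i)
      shape i with i <? a | i ≤? d | i ≤? b
      ... | yes i<a | _ | _ = low i<a (first i<a)
      ... | no i≮a | yes i≤d | _ = up (≮⇒≥ i≮a)
        (subst (i <_) (trans (cong suc (sym a+w≡d)) (sym (+-suc a w))) (s≤s i≤d)) value
        where
        value : f i ≡ i + suc z
        value with k , refl ← m≤n⇒∃[o]m+o≡n (≮⇒≥ i≮a) = begin
          f (a + k)       ≡⟨ second k i≤d ⟩
          suc e + k       ≡⟨ cong (λ x → suc x + k) a+z≡e ⟨
          suc (a + z) + k ≡⟨ lemma a z k ⟩
          a + k + suc z   ∎
          where
          open ≡-Reasoning
          lemma : ∀ a z k → suc (a + z) + k ≡ a + k + suc z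
          lemma = solve-∀
      ... | no _ | no i≰d | no i≰b = high (subst (_≤ i) (sym c≡1+b) (≰⇒> i≰b)) (fourth (≰⇒> i≰b))
      ... | no _ | no i≰d | yes i≤b with k , i+k≡b ← m≤n⇒∃[o]m+o≡n i≤b = down
        (subst (_≤ f i) third-start (rising-≤ {f} (rises-after {f} ↓f) ≤-refl (≰⇒> i≰d) ≤-refl))
        (≤-trans (s≤s fi≤e) (≤-reflexive (trans (cong suc (sym a+z≡e)) (sym (+-suc a z)))))
        (+-cancelʳ-≡ k i (f i + suc w) (begin
          i + k           ≡⟨ trans i+k≡b (sym 1+d+z≡b) ⟩
          suc d + z       ≡⟨ cong (λ x → suc x + z) a+w≡d ⟨
          suc (a + w) + z ≡⟨ lemma₁ a w z ⟩
          a + z + suc w   ≡⟨ cong (_+ suc w) (trans a+z≡e (sym fi+k≡e)) ⟩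
          f i + k + suc w ≡⟨ lemma₂ (f i) k w ⟩
          f i + suc w + k ∎))
        where
        open ≡-Reasoning
        fi+k≡e : f i + k ≡ e
        fi+k≡e = third k (≰⇒> i≰d) i+k≡b
        fi≤e : f i ≤ e
        fi≤e = m+n≤o⇒m≤o (f i) (≤-reflexive fi+k≡e)
        lemma₁ : ∀ a w z → suc (a + w) + z ≡ a + z + suc w
        lemma₁ = solve-∀
        lemma₂ : ∀ v k w → v + k + suc w ≡ v + suc w + k
        lemma₂ = solve-∀

  -- The one-line notation, indexed from 0 and continued by the identity.
  entry : ∀ {n} → Permutation′ n → ℕ → ℕ
  entry {n} ω i with i <? n
  ... | yes i<n = toℕ (ω ⟨$⟩ʳ fromℕ< i<n)
  ... | no  _   = i

  module _ {n : ℕ} (ω : Permutation′ n) where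

    entry-toℕ : ∀ i → entry ω (toℕ i) ≡ toℕ (ω ⟨$⟩ʳ i)
    entry-toℕ i with toℕ i <? n
    ... | yes i<n = cong (λ j → toℕ (ω ⟨$⟩ʳ j)) (Fin.fromℕ<-toℕ i i<n)
    ... | no  i≮n = contradiction (Fin.toℕ<n i) i≮n

    entry-≥ : ∀ {i} → n ≤ i → entry ω i ≡ i
    entry-≥ {i} n≤i with i <? n
    ... | yes i<n = contradiction i<n (≤⇒≯ n≤i)
    ... | no  _   = refl

    entry-< : ∀ {i} → i < n → entry ω i < n
    entry-< {i} i<n with i <? n
    ... | yes _   = Fin.toℕ<n _
    ... | no  i≮n = contradiction i<n i≮n

  data InFin (n : ℕ) : ℕ → Set where
    inside  : (i : Fin n) → InFin n (toℕ i)
    outside : ∀ {i} → n ≤ i → InFin n i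

  inFin : ∀ n i → InFin n i
  inFin n i with i <? n
  ... | yes i<n = subst (InFin n) (Fin.toℕ-fromℕ< i<n) (inside (fromℕ< i<n))
  ... | no  i≮n = outside (≮⇒≥ i≮n)

  module _ {n : ℕ} where

    entry-flip : ∀ (ω : Permutation′ n) i → entry (flip ω) (entry ω i) ≡ i
    entry-flip ω i with inFin n i
    ... | inside j rewrite entry-toℕ ω j | entry-toℕ (flip ω) (ω ⟨$⟩ʳ j) = cong toℕ (inverseˡ ω)
    ... | outside n≤i rewrite entry-≥ ω n≤i = entry-≥ (flip ω) n≤i

    entry-injective : ∀ (ω : Permutation′ n) {i j} → entry ω i ≡ entry ω j → i ≡ j
    entry-injective ω {i} {j} eq =
      trans (sym (entry-flip ω i)) (trans (cong (entry (flip ω)) eq) (entry-flip ω j))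

    ≈⇒entry : {π σ : Permutation′ n} → π ≈ σ → ∀ i → entry π i ≡ entry σ i
    ≈⇒entry {π} {σ} π≈σ i with inFin n i
    ... | inside j    = trans (entry-toℕ π j) (trans (cong toℕ (π≈σ j)) (sym (entry-toℕ σ j)))
    ... | outside n≤i = trans (entry-≥ π n≤i) (sym (entry-≥ σ n≤i))

    entry⇒≈ : {π σ : Permutation′ n} → (∀ i → entry π i ≡ entry σ i) → π ≈ σ
    entry⇒≈ {π} {σ} eq i = Fin.toℕ-injective
      (trans (sym (entry-toℕ π i)) (trans (eq (toℕ i)) (entry-toℕ σ i)))

    transpose-left : ∀ (i j : Fin n) → PC.transpose i j i ≡ j
    transpose-left i j rewrite dec-true (i Fin.≟ i) refl = refl

    transpose-right : ∀ (i j : Fin n) → PC.transpose i j j ≡ i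
    transpose-right i j with j Fin.≟ i
    ... | yes j≡i = j≡i
    ... | no  _ rewrite dec-true (j Fin.≟ j) refl = refl

    transpose-other : ∀ {i j k : Fin n} → k ≢ i → k ≢ j → PC.transpose i j k ≡ k
    transpose-other {i} {j} {k} k≢i k≢j
      rewrite dec-false (k Fin.≟ i) k≢i | dec-false (k Fin.≟ j) k≢j = refl

  -- Reductions, displacements and inverses.

  Swapped : ℕ → ℕ → (f g : ℕ → ℕ) → Set
  Swapped i j f g = g i ≡ f j × g j ≡ f i × ∀ {k} → k ≢ i → k ≢ j → g k ≡ f k

  module _ {f g : ℕ → ℕ} {i j t : ℕ} (i<j : i < j) (fj<fi : f j < f i) where

    -- The larger entry `f i` goes to `j > i`, where the bound is weaker, and `i` receives a smaller
    -- entry. An initial segment containing `j` contains `i` too. With `t = 0` this governs fixed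
    -- initial segments, with larger `t` the displacement to the right.
    swapped-upper : ∀ {b} → Swapped i j f g → (∀ {k} → k < b → f k ≤ k + t) →
                    ∀ {k} → k < b → g k ≤ k + t
    swapped-upper (at-i , at-j , elsewhere) h {k} k<b with k ≟ i | k ≟ j
    ... | yes refl | _        rewrite at-i = ≤-trans (<⇒≤ fj<fi) (h k<b)
    ... | no _     | yes refl rewrite at-j =
      ≤-trans (h (<-trans i<j k<b)) (+-monoˡ-≤ t (<⇒≤ i<j))
    ... | no k≢i   | no k≢j   rewrite elsewhere k≢i k≢j = h k<b

    -- The mirror image: a final segment containing `i` contains `j` too.
    swapped-lower : ∀ {c} → Swapped i j f g → (∀ {k} → c ≤ k → k ≤ f k + t) →
                    ∀ {k} → c ≤ k → k ≤ g k + t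
    swapped-lower (at-i , at-j , elsewhere) h {k} c≤k with k ≟ i | k ≟ j
    ... | yes refl | _        rewrite at-i = ≤-trans (<⇒≤ i<j) (h (≤-trans c≤k (<⇒≤ i<j)))
    ... | no _     | yes refl rewrite at-j = ≤-trans (h c≤k) (+-monoˡ-≤ t (<⇒≤ fj<fi))
    ... | no k≢i   | no k≢j   rewrite elsewhere k≢i k≢j = h c≤k

  module _ {n : ℕ} where

    transpose-swapped : ∀ (ω : Permutation′ n) i j →
      Swapped (toℕ i) (toℕ j) (entry ω) (entry (transpose i j ∘ₚ ω))
    transpose-swapped ω i j = at i (transpose-left i j) , at j (transpose-right i j) , elsewhere
      where
      ρ = transpose i j ∘ₚ ω

      at : ∀ k {l} → PC.transpose i j k ≡ l → entry ρ (toℕ k) ≡ entry ω (toℕ l)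
      at k refl = trans (entry-toℕ ρ k) (sym (entry-toℕ ω (PC.transpose i j k)))

      elsewhere : ∀ {k} → k ≢ toℕ i → k ≢ toℕ j → entry ρ k ≡ entry ω k
      elsewhere {k} k≢i k≢j with inFin n k
      ... | inside l    = at l (transpose-other (k≢i ∘ cong toℕ) (k≢j ∘ cong toℕ))
      ... | outside n≤k = trans (entry-≥ ρ n≤k) (sym (entry-≥ ω n≤k))

    reduction-swaps : {ω ρ : Permutation′ n} → ω ⟶ ρ →
      ∃₂ λ i j → i < j × entry ω j < entry ω i × Swapped i j (entry ω) (entry ρ)
    reduction-swaps {ω} (reduce {i} {j} i<j ωj<ωi) =
      toℕ i , toℕ j , i<j , subst₂ _<_ (sym (entry-toℕ ω j)) (sym (entry-toℕ ω i)) ωj<ωi ,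
      transpose-swapped ω i j

    reduceAt : ∀ (ω : Permutation′ n) {i j} → i < j → j < n → entry ω j < entry ω i →
      ∃ λ ρ → ω ⟶ ρ × Swapped i j (entry ω) (entry ρ)
    reduceAt ω {i} {j} i<j j<n ωj<ωi with inFin n i | inFin n j
    ... | outside n≤i | _           = contradiction (<-trans i<j j<n) (≤⇒≯ n≤i)
    ... | inside _    | outside n≤j = contradiction j<n (≤⇒≯ n≤j)
    ... | inside i′   | inside j′   = transpose i′ j′ ∘ₚ ω ,
      reduce i<j (subst₂ _<_ (entry-toℕ ω j′) (entry-toℕ ω i′) ωj<ωi) , transpose-swapped ω i′ j′

    ≤ᴮ-upper : ∀ {π σ : Permutation′ n} {b t} → π ≤ᴮ σ →
               (∀ {k} → k < b → entry σ k ≤ k + t) → ∀ {k} → k < b → entry π k ≤ k + t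
    ≤ᴮ-upper {π} {b = b} {t} (ρ , steps , ρ≈π) = along steps
      where
      along : ∀ {σ} → Star _⟶_ σ ρ → (∀ {k} → k < b → entry σ k ≤ k + t) →
              ∀ {k} → k < b → entry π k ≤ k + t
      along ε h {k} k<b = subst (_≤ k + t) (≈⇒entry {π = ρ} {π} ρ≈π k) (h k<b)
      along (step ◅ steps) h with _ , _ , i<j , σj<σi , swapped ← reduction-swaps step =
        along steps (swapped-upper i<j σj<σi swapped h)

    ≤ᴮ-lower : ∀ {π σ : Permutation′ n} {c t} → π ≤ᴮ σ →
               (∀ {k} → c ≤ k → k ≤ entry σ k + t) → ∀ {k} → c ≤ k → k ≤ entry π k + t
    ≤ᴮ-lower {π} {c = c} {t} (ρ , steps , ρ≈π) = along steps
      where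
      along : ∀ {σ} → Star _⟶_ σ ρ → (∀ {k} → c ≤ k → k ≤ entry σ k + t) →
              ∀ {k} → c ≤ k → k ≤ entry π k + t
      along ε h {k} c≤k = subst (λ v → k ≤ v + t) (≈⇒entry {π = ρ} {π} ρ≈π k) (h c≤k)
      along (step ◅ steps) h with _ , _ , i<j , σj<σi , swapped ← reduction-swaps step =
        along steps (swapped-lower i<j σj<σi swapped h)

    ≤ᴮ-reflexive : {π σ : Permutation′ n} → σ ≈ π → π ≤ᴮ σ
    ≤ᴮ-reflexive {σ = σ} eq = σ , ε , eq

    private
      -- A chain reaches its target only up to `_≈_`, so for transitivity the next chain is replayed
      -- from a pointwise equal start.
      star-resp : ∀ {σ ρ σ′ : Permutation′ n} → Star _⟶_ σ ρ → σ ≈ σ′ →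
                  ∃ λ ρ′ → Star _⟶_ σ′ ρ′ × ρ ≈ ρ′
      star-resp {σ′ = σ′} ε eq = σ′ , ε , eq
      star-resp {σ} {σ′ = σ′} (reduce {i} {j} i<j σj<σi ◅ steps) eq
        with ρ′ , steps′ , eq′ ← star-resp {σ′ = transpose i j ∘ₚ σ′} steps (λ k → eq (PC.transpose i j k)) =
        ρ′ , reduce i<j (subst₂ Fin._<_ (eq j) (eq i) σj<σi) ◅ steps′ , eq′

    ≤ᴮ-trans : ∀ {π σ τ : Permutation′ n} → π ≤ᴮ σ → σ ≤ᴮ τ → π ≤ᴮ τ
    ≤ᴮ-trans (_ , steps₁ , eq₁) (_ , steps₂ , eq₂)
      with ρ , steps , eq ← star-resp steps₁ (sym ∘ eq₂) =
      ρ , steps₂ ◅◅ steps , λ i → trans (sym (eq i)) (eq₁ i)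

    private
      -- An exchange at the positions `i < j` of `ω` is an exchange at the positions `ω j < ω i` of
      -- the inverse; the two inequalities of `reduce` trade roles. The conclusion is not a single
      -- `_⟶_` because the resulting inverses are shown to agree pointwise.
      flip-step : ∀ {ω ρ : Permutation′ n} → ω ⟶ ρ → flip ρ ≤ᴮ flip ω
      flip-step {ω} (reduce {i} {j} i<j ωj<ωi) =
        transpose (ω ⟨$⟩ʳ j) (ω ⟨$⟩ʳ i) ∘ₚ flip ω ,
        reduce ωj<ωi (subst₂ Fin._<_ (sym (inverseˡ ω)) (sym (inverseˡ ω)) i<j) ◅ ε ,
        same
        where
        same : ∀ v → ω ⟨$⟩ˡ PC.transpose (ω ⟨$⟩ʳ j) (ω ⟨$⟩ʳ i) v ≡ PC.transpose j i (ω ⟨$⟩ˡ v)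
        same v with v Fin.≟ ω ⟨$⟩ʳ j
        ... | yes refl = trans (inverseˡ ω)
          (sym (trans (cong (PC.transpose j i) (inverseˡ ω)) (transpose-left j i)))
        ... | no v≢j with v Fin.≟ ω ⟨$⟩ʳ i
        ...   | yes refl = trans (inverseˡ ω)
          (sym (trans (cong (PC.transpose j i) (inverseˡ ω)) (transpose-right j i)))
        ...   | no v≢i = sym (transpose-other
          (λ eq → v≢j (trans (sym (inverseʳ ω)) (cong (ω ⟨$⟩ʳ_) eq)))
          (λ eq → v≢i (trans (sym (inverseʳ ω)) (cong (ω ⟨$⟩ʳ_) eq))))

    ≤ᴮ-flip : ∀ {π σ : Permutation′ n} → π ≤ᴮ σ → flip π ≤ᴮ flip σ
    ≤ᴮ-flip {π} (ρ , steps , ρ≈π) = along steps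
      where
      along : ∀ {σ} → Star _⟶_ σ ρ → flip π ≤ᴮ flip σ
      along ε = ≤ᴮ-reflexive {flip π} {flip ρ}
        (entry⇒≈ {π = flip ρ} {flip π} λ v → entry-injective π (begin
          entry π (entry (flip ρ) v) ≡⟨ ≈⇒entry {π = ρ} {π} ρ≈π _ ⟨
          entry ρ (entry (flip ρ) v) ≡⟨ entry-flip (flip ρ) v ⟩
          v                          ≡⟨ entry-flip (flip π) v ⟨
          entry π (entry (flip π) v) ∎))
        where open ≡-Reasoning
      along {σ} (_◅_ {j = σ′} step steps) =
        ≤ᴮ-trans {flip π} {flip σ′} {flip σ} (along steps) (flip-step step)

  -- Moving a single entry past a block.

  MovedLeft MovedRight : ℕ → ℕ → (f g : ℕ → ℕ) → Set
  MovedLeft i k f g =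
    g i ≡ f (i + k) ×
    (∀ {l} → i ≤ l → l < i + k → g (suc l) ≡ f l) ×
    (∀ {l} → l < i ⊎ i + k < l → g l ≡ f l)
  MovedRight i k f g =
    g (i + k) ≡ f i ×
    (∀ {l} → i ≤ l → l < i + k → g l ≡ f (suc l)) ×
    (∀ {l} → l < i ⊎ i + k < l → g l ≡ f l)

  module _ {n : ℕ} where

    -- The entry is first carried to `i + 1`, then exchanged with its left neighbour. It is smaller
    -- than everything it passes, so each exchange is a reduction.
    moveLeft : ∀ k {i} (ω : Permutation′ n) → i + k < n →
      (∀ {l} → i ≤ l → l < i + k → entry ω (i + k) < entry ω l) →
      ∃ λ ρ → Star _⟶_ ω ρ × MovedLeft i k (entry ω) (entry ρ)
    moveLeft zero {i} ω _ _ rewrite +-identityʳ i =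
      ω , ε , refl , (λ i≤l l<i → contradiction l<i (≤⇒≯ i≤l)) , λ _ → refl
    moveLeft (suc k) {i} ω bound smaller rewrite +-suc i k
      with ρ , steps , at-i , shifted , others ←
             moveLeft k {suc i} ω bound (λ i<l → smaller (<⇒≤ i<l))
      with ρ′ , step , swap-i , swap-si , swap-others ←
             reduceAt ρ (n<1+n i) (≤-<-trans (s≤s (m≤m+n i k)) bound)
               (subst₂ _<_ (sym at-i) (sym (others (inj₁ (n<1+n i)))) (smaller ≤-refl (s≤s (m≤m+n i k)))) =
      ρ′ , steps ◅◅ step ◅ ε , trans swap-i at-i , shifted′ , others′
      where
      shifted′ : ∀ {l} → i ≤ l → l < suc (i + k) → entry ρ′ (suc l) ≡ entry ω l
      shifted′ {l} i≤l l<j with m≤n⇒m<n∨m≡n i≤l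
      ... | inj₂ refl = trans swap-si (others (inj₁ (n<1+n i)))
      ... | inj₁ i<l  = trans
        (swap-others (≢-sym (<⇒≢ (m≤n⇒m≤1+n i<l))) (≢-sym (<⇒≢ (s≤s i<l)))) (shifted i<l l<j)

      others′ : ∀ {l} → l < i ⊎ suc (i + k) < l → entry ρ′ l ≡ entry ω l
      others′ (inj₁ l<i) = trans (swap-others (<⇒≢ l<i) (<⇒≢ (m≤n⇒m≤1+n l<i)))
        (others (inj₁ (m≤n⇒m≤1+n l<i)))
      others′ {l} (inj₂ j<l) = trans
        (swap-others (≢-sym (<⇒≢ (<⇒≤ 1+i<l))) (≢-sym (<⇒≢ 1+i<l))) (others (inj₂ j<l))
        where
        1+i<l : suc i < l
        1+i<l = ≤-<-trans (s≤s (m≤m+n i k)) j<l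

    moveRight : ∀ k {i} (ω : Permutation′ n) → i + k < n →
      (∀ {l} → i < l → l ≤ i + k → entry ω l < entry ω i) →
      ∃ λ ρ → Star _⟶_ ω ρ × MovedRight i k (entry ω) (entry ρ)
    moveRight zero {i} ω _ _ rewrite +-identityʳ i =
      ω , ε , refl , (λ i≤l l<i → contradiction l<i (≤⇒≯ i≤l)) , λ _ → refl
    moveRight (suc k) {i} ω bound larger rewrite +-suc i k
      with ρ , steps , at-j , shifted , others ←
             moveRight k {i} ω (<⇒≤ bound) (λ i<l l≤j → larger i<l (m≤n⇒m≤1+n l≤j))
      with ρ′ , step , swap-j , swap-sj , swap-others ←
             reduceAt ρ (n<1+n (i + k)) bound
               (subst₂ _<_ (sym (others (inj₂ (n<1+n (i + k))))) (sym at-j) (larger (s≤s (m≤m+n i k)) ≤-refl)) =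
      ρ′ , steps ◅◅ step ◅ ε , trans swap-sj at-j , shifted′ , others′
      where
      shifted′ : ∀ {l} → i ≤ l → l < suc (i + k) → entry ρ′ l ≡ entry ω (suc l)
      shifted′ {l} i≤l l≤j with m≤n⇒m<n∨m≡n l≤j
      ... | inj₂ refl = trans swap-j (others (inj₂ (n<1+n (i + k))))
      ... | inj₁ (s≤s l<j) = trans
        (swap-others (<⇒≢ l<j) (<⇒≢ l≤j)) (shifted i≤l l<j)

      others′ : ∀ {l} → l < i ⊎ suc (i + k) < l → entry ρ′ l ≡ entry ω l
      others′ {l} (inj₁ l<i) = trans (swap-others (<⇒≢ l<j) (<⇒≢ (m≤n⇒m≤1+n l<j)))
        (others (inj₁ l<i))
        where
        l<j : l < i + k
        l<j = <-≤-trans l<i (m≤m+n i k)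
      others′ (inj₂ j<l) = trans
        (swap-others (≢-sym (<⇒≢ (<⇒≤ j<l))) (≢-sym (<⇒≢ j<l))) (others (inj₂ (<⇒≤ j<l)))

  Shape : ∀ {n} → Permutation′ n → ℕ → ℕ → ℕ → Set
  Shape ω a z w = ∀ i → BlockSwap a z w i (entry ω i)

  module _ {n : ℕ} where

    shape-flip : ∀ {ω : Permutation′ n} {a z w} → Shape ω a z w → Shape (flip ω) a w z
    shape-flip {ω} shape v = BlockSwap-flip
      (subst (BlockSwap _ _ _ _) (entry-flip (flip ω) v) (shape (entry (flip ω) v)))

    shape-unique : ∀ {π σ : Permutation′ n} {a z w} → Shape π a z w → Shape σ a z w → π ≈ σ
    shape-unique {π} {σ} shape-π shape-σ =
      entry⇒≈ {π = π} {σ} λ i → BlockSwap-functional (shape-π i) (shape-σ i)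

    shape-entry : ∀ {ω : Permutation′ n} {a z w i v} → Shape ω a z w → BlockSwap a z w i v →
      entry ω i ≡ v
    shape-entry {i = i} shape = BlockSwap-functional (shape i)

    Reaches : Permutation′ n → ℕ → ℕ → ℕ → Set
    Reaches σ a z w = ∃ λ ρ → ρ ≤ᴮ σ × Shape ρ a z w

    -- The value `a` opens the second block, at position `a + w`. Carried left past the first block
    -- it becomes a fixed point, while the end of the swapped region stays in place.
    raise-a-lower-z : ∀ {σ : Permutation′ n} a z w → a + w + suc z ≤ n → Shape σ a (suc z) w →
                      Reaches σ (suc a) z w
    raise-a-lower-z {σ} a z w c≤n shape =
      let ρ , steps , moved = moveLeft w {a} σ
            (<-≤-trans (m<m+n (a + w) (s≤s z≤n)) c≤n)
            (λ {l} a≤l l<b → subst₂ _<_ (sym first) (sym (shape-entry {ω = σ} shape (up a≤l l<b refl)))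
                               (≤-<-trans a≤l (m<m+n l (s≤s z≤n))))
      in ρ , (ρ , steps , λ _ → refl) , shape′ ρ moved
      where
      first : entry σ (a + w) ≡ a
      first = shape-entry {ω = σ} shape (down ≤-refl (m<m+n a (s≤s z≤n)) refl)

      shape′ : ∀ (ρ : Permutation′ n) → MovedLeft a w (entry σ) (entry ρ) → Shape ρ (suc a) z w
      shape′ ρ (at-a , shifted , others) i with <-cmp i a
      ... | tri< i<a _ _ = low (m≤n⇒m≤1+n i<a)
        (trans (others (inj₁ i<a)) (shape-entry {ω = σ} shape (low i<a refl)))
      ... | tri≈ _ refl _ = low ≤-refl (trans at-a first)
      shape′ ρ (at-a , shifted , others) (suc l) | tri> _ _ (s≤s a≤l) with suc l ≤? a + w
      ... | yes l<b = up (s≤s a≤l) (s≤s l<b)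
        (trans (shifted a≤l l<b) (trans (shape-entry {ω = σ} shape (up a≤l l<b refl)) (+-suc l z)))
      ... | no l≮b rewrite others (inj₂ (≰⇒> l≮b)) with shape (suc l)
      ...   | low i<a _ = contradiction (s≤s a≤l) (<⇒≯ i<a)
      ...   | up _ i<b _ = contradiction i<b (λ i<b → l≮b (<⇒≤ i<b))
      ...   | down a≤v v<a+z eq = down
        (+-cancelʳ-< w a _ (subst (a + w <_) eq (≰⇒> l≮b)))
        (≤-trans v<a+z (≤-reflexive (+-suc a z))) eq
      ...   | high c≤i eq = high (≤-trans (≤-reflexive (sym (+-suc (a + w) z))) c≤i) eq

    -- The last entry of the first block is `a + w + z`. Carried right past the second block it
    -- lands on the position of that number and becomes fixed, so the swapped region ends one
    -- position earlier.
    lower-w : ∀ {σ : Permutation′ n} a z w → a + suc w + z ≤ n → Shape σ a z (suc w) →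
              Reaches σ a z w
    lower-w {σ} a z w c≤n shape =
      let ρ , steps , moved = moveRight z {a + w} σ
            (≤-trans (≤-reflexive (cong (_+ z) (sym (+-suc a w)))) c≤n)
            (λ {l} b<l l≤c → subst (entry σ l <_) (sym last) (downs b<l l≤c))
      in ρ , (ρ , steps , λ _ → refl) , shape′ ρ moved
      where
      last : entry σ (a + w) ≡ a + w + z
      last = shape-entry {ω = σ} shape
        (up (m≤m+n a w) (≤-reflexive (sym (+-suc a w))) refl)

      -- Describes the entry that slides from `l + 1` to `l`. It serves both to justify the move and
      -- to read off the new shape.
      block : ∀ {l} → a + w ≤ l → l < a + w + z →
              ∃ λ v → a ≤ v × v < a + z × l ≡ v + w × entry σ (suc l) ≡ v
      block b≤l l<c with k , refl ← m≤n⇒∃[o]m+o≡n b≤l =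
        a + k , m≤m+n a k , +-monoʳ-< a k<z , lemma a w k ,
        shape-entry {ω = σ} shape (down (m≤m+n a k) (+-monoʳ-< a k<z) (lemma₁ a w k))
        where
        k<z : k < z
        k<z = +-cancelˡ-< (a + w) k z l<c
        lemma : ∀ a w k → a + w + k ≡ a + k + w
        lemma = solve-∀
        lemma₁ : ∀ a w k → suc (a + w + k) ≡ a + k + suc w
        lemma₁ = solve-∀

      downs : ∀ {l} → a + w < l → l ≤ a + w + z → entry σ l < a + w + z
      downs {suc l} (s≤s b≤l) l<c with v , _ , v<a+z , refl , eq ← block b≤l l<c rewrite eq =
        <-≤-trans v<a+z (+-monoˡ-≤ z (m≤m+n a w))

      shape′ : ∀ (ρ : Permutation′ n) → MovedRight (a + w) z (entry σ) (entry ρ) → Shape ρ a z w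
      shape′ ρ (at-c , shifted , others) i with i <? a + w | <-cmp i (a + w + z)
      ... | no _ | tri≈ _ refl _ = high ≤-refl (trans at-c last)
      ... | no i≮b | tri< i<c _ _ with v , a≤v , v<a+z , i≡v+w , eq ← block (≮⇒≥ i≮b) i<c =
        subst (BlockSwap a z w i) (sym (trans (shifted (≮⇒≥ i≮b) i<c) eq)) (down a≤v v<a+z i≡v+w)
      ... | no _ | tri> _ _ c<i = high (<⇒≤ c<i) (trans (others (inj₂ c<i))
        (shape-entry {ω = σ} shape (high (subst (_≤ i) (cong (_+ z) (sym (+-suc a w))) c<i) refl)))
      ... | yes i<b | _ rewrite others (inj₁ i<b) with i <? a
      ...   | yes i<a = low i<a (shape-entry {ω = σ} shape (low i<a refl))
      ...   | no i≮a  = up (≮⇒≥ i≮a) i<b (shape-entry {ω = σ} shape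
        (up (≮⇒≥ i≮a) (<-≤-trans i<b (+-monoʳ-≤ a (n≤1+n w))) refl))

  BlockSwap-upper : ∀ {a z w i v} → BlockSwap a z w i v → v ≤ i + z
  BlockSwap-upper {i = i} (low _ refl)      = m≤m+n i _
  BlockSwap-upper         (up _ _ refl)     = ≤-refl
  BlockSwap-upper {v = v} (down _ _ refl)   = ≤-trans (m≤m+n v _) (m≤m+n (v + _) _)
  BlockSwap-upper {i = i} (high _ refl)     = m≤m+n i _

  module _ {n : ℕ} where

    -- With both blocks nonempty, the last position of the swapped region is not fixed, whereas all
    -- positions from `n` on are.
    shape-bound : ∀ {ω : Permutation′ n} {a z w} → Shape ω a (suc z) (suc w) → a + suc w + suc z ≤ n
    shape-bound {ω} {a} {z} {w} shape = subst (_≤ n) (sym (+-suc (a + suc w) z)) (≰⇒> λ n≤i →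
      contradiction (trans (sym (entry-≥ ω n≤i)) (shape-entry {ω = ω} shape moved)) (>⇒≢ decreases))
      where
      moved : BlockSwap a (suc z) (suc w) (a + suc w + z) (a + z)
      moved = down (m≤m+n a z) (+-monoʳ-< a (n<1+n z)) (lemma a w z)
        where
        lemma : ∀ a w z → a + suc w + z ≡ a + z + suc w
        lemma = solve-∀
      decreases : a + z < a + suc w + z
      decreases = +-monoˡ-< z (m<m+n a (s≤s z≤n))

    reaches-trans : ∀ {σ : Permutation′ n} {a z w a′ z′ w′} → Reaches σ a z w →
      (∀ {ρ : Permutation′ n} → Shape ρ a z w → Reaches ρ a′ z′ w′) → Reaches σ a′ z′ w′
    reaches-trans {σ} (ρ , ρ≤σ , shape) next with τ , τ≤ρ , shape′ ← next shape =
      τ , ≤ᴮ-trans {π = τ} {ρ} {σ} τ≤ρ ρ≤σ , shape′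

    -- Inversion exchanges `z` and `w`. This yields the two remaining moves, from `w` to `a` and
    -- from `z` to `b`.
    reaches-flip : ∀ {σ : Permutation′ n} {a z w} → Reaches (flip σ) a w z → Reaches σ a z w
    reaches-flip {σ} (ρ , ρ≤σ⁻¹ , shape) =
      flip ρ , ≤ᴮ-flip {π = ρ} {flip σ} ρ≤σ⁻¹ , shape-flip {ω = ρ} shape

    raise-a-lower-z* : ∀ k {σ : Permutation′ n} {a z w} → Shape σ a (suc (k + z)) (suc w) →
                       Reaches σ (k + a) (suc z) (suc w)
    raise-a-lower-z* zero    {σ} shape = σ , ≤ᴮ-reflexive {π = σ} {σ} (λ _ → refl) , shape
    raise-a-lower-z* (suc k) {σ} {a} {z} {w} shape = subst (λ a → Reaches σ a (suc z) (suc w)) (+-suc k a)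
      (reaches-trans {σ = σ}
        (raise-a-lower-z {σ = σ} a (suc (k + z)) (suc w) (shape-bound {ω = σ} shape) shape)
        (λ {ρ} → raise-a-lower-z* k {ρ}))

    lower-w* : ∀ k {σ : Permutation′ n} {a z w} → Shape σ a (suc z) (suc (k + w)) →
               Reaches σ a (suc z) (suc w)
    lower-w* zero    {σ} shape = σ , ≤ᴮ-reflexive {π = σ} {σ} (λ _ → refl) , shape
    lower-w* (suc k) {σ} {a} {z} {w} shape = reaches-trans {σ = σ}
      (lower-w {σ = σ} a (suc z) (suc (k + w)) (shape-bound {ω = σ} shape) shape)
      (λ {ρ} → lower-w* k {ρ})

    raise-a-lower-w* : ∀ k {σ : Permutation′ n} {a z w} → Shape σ a (suc z) (suc (k + w)) →
                       Reaches σ (k + a) (suc z) (suc w)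
    raise-a-lower-w* k {σ} shape =
      reaches-flip {σ = σ} (raise-a-lower-z* k {flip σ} (shape-flip {ω = σ} shape))

    lower-z* : ∀ k {σ : Permutation′ n} {a z w} → Shape σ a (suc (k + z)) (suc w) →
               Reaches σ a (suc z) (suc w)
    lower-z* k {σ} shape = reaches-flip {σ = σ} (lower-w* k {flip σ} (shape-flip {ω = σ} shape))

  -- The permutation 1 ⋯ a (b+1) ⋯ c (a+1) ⋯ b (c+1) ⋯ n of 𝔅ₙ is coded by
  -- (a, b-a-1, c-b-1, n-c); such codes are the 4-tuples with sum n-2.
  Code : Set
  Code = Vec ℕ 4

  Represents : ∀ {n} → Permutation′ n → Code → Set
  Represents ω (a ∷ z ∷ w ∷ b ∷ []) = Shape ω a (suc z) (suc w)

  -- If π ≤ σ then the outer entries of the code of π exceed those of σ by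
  -- α and β, the inner ones fall short by ζ and μ, and α + β = ζ + μ.  The
  -- solutions with α ≥ ζ and those with α < ζ are parametrised separately.
  pair₁ pair₂ : Vec ℕ 7 → Code × Code
  pair₁ (a ∷ z ∷ w ∷ b ∷ ζ ∷ β ∷ x ∷ []) =
    (x + (ζ + a) ∷ z ∷ w ∷ β + b ∷ []) , (a ∷ ζ + z ∷ β + (x + w) ∷ b ∷ [])
  pair₂ (a ∷ z ∷ w ∷ b ∷ α ∷ μ ∷ x ∷ []) =
    (α + a ∷ z ∷ w ∷ suc x + (μ + b) ∷ []) , (a ∷ α + (suc x + z) ∷ μ + w ∷ b ∷ [])

  module _ {n : ℕ} {π σ : Permutation′ n} where

    reached : ∀ {a z w} → Shape π a z w → Reaches σ a z w → π ≤ᴮ σ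
    reached shape-π (ρ , ρ≤σ , shape-ρ) = ≤ᴮ-trans {π = π} {ρ} {σ}
      (≤ᴮ-reflexive {π = π} {ρ} (shape-unique {π = ρ} {π} shape-ρ shape-π)) ρ≤σ

    -- The moves shift `ζ` from `z` to `a`, then `β` from `w` to `b`, then `x` from `w` to `a`; the
    -- sums in `pair₁` are bracketed in this order.
    pair₁-≤ᴮ : ∀ t → Represents π (proj₁ (pair₁ t)) → Represents σ (proj₂ (pair₁ t)) → π ≤ᴮ σ
    pair₁-≤ᴮ (a ∷ z ∷ w ∷ b ∷ ζ ∷ β ∷ x ∷ []) shape-π shape-σ = reached shape-π
      (reaches-trans {n = n} {σ = σ} (raise-a-lower-z* {n = n} ζ {σ} shape-σ) λ {ρ} shape-ρ →
       reaches-trans {n = n} {σ = ρ} (lower-w* {n = n} β {ρ} shape-ρ) λ {τ} →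
       raise-a-lower-w* {n = n} x {τ})

    -- Here `a` gains from `z` alone; the surplus `suc x` of `z` and all of `μ` go to `b`.
    pair₂-≤ᴮ : ∀ t → Represents π (proj₁ (pair₂ t)) → Represents σ (proj₂ (pair₂ t)) → π ≤ᴮ σ
    pair₂-≤ᴮ (a ∷ z ∷ w ∷ b ∷ α ∷ μ ∷ x ∷ []) shape-π shape-σ = reached shape-π
      (reaches-trans {n = n} {σ = σ} (raise-a-lower-z* {n = n} α {σ} shape-σ) λ {ρ} shape-ρ →
       reaches-trans {n = n} {σ = ρ} (lower-w* {n = n} μ {ρ} shape-ρ) λ {τ} →
       lower-z* {n = n} (suc x) {τ})

    -- Each invariant is tested at one entry of `π`. Position `a′` has the largest displacement to
    -- the right and bounds `a` and `z`; the value `a′` has the largest displacement to the left and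
    -- bounds `w`; the last position of the swapped region bounds its end, which stands in for `b`.
    ≤ᴮ⇒blocks : ∀ {a z w a′ z′ w′} → Shape π a′ (suc z′) (suc w′) → Shape σ a (suc z) (suc w) →
      π ≤ᴮ σ →
      a ≤ a′ × z′ ≤ z × w′ ≤ w × a′ + suc w′ + suc z′ ≤ a + suc w + suc z
    ≤ᴮ⇒blocks {a} {z} {w} {a′} {z′} {w′} shape-π shape-σ π≤σ = a≤a′ , z′≤z , w′≤w , c′≤c
      where
      a′-moved : entry π a′ ≡ a′ + suc z′
      a′-moved = shape-entry {ω = π} shape-π (up ≤-refl (m<m+n a′ (s≤s z≤n)) refl)

      a≤a′ : a ≤ a′
      a≤a′ = ≮⇒≥ λ a′<a → contradiction
        (subst₂ _≤_ a′-moved (+-identityʳ a′) (≤ᴮ-upper {π = π} {σ} {t = 0} π≤σ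
          (λ {k} k<a → ≤-trans (≤-reflexive (shape-entry {ω = σ} shape-σ (low k<a refl))) (m≤m+n k 0))
          a′<a))
        (<⇒≱ (m<m+n a′ (s≤s z≤n)))

      z′≤z : z′ ≤ z
      z′≤z = s≤s⁻¹ (+-cancelˡ-≤ a′ _ _ (subst (_≤ a′ + suc z) a′-moved
        (≤ᴮ-upper {π = π} {σ} {suc a′} π≤σ (λ {k} _ → BlockSwap-upper (shape-σ k)) ≤-refl)))

      w′≤w : w′ ≤ w
      w′≤w = s≤s⁻¹ (+-cancelˡ-≤ a′ _ _ (subst (λ v → a′ + suc w′ ≤ v + suc w)
        (shape-entry {ω = π} shape-π (down ≤-refl (m<m+n a′ (s≤s z≤n)) refl))
        (≤ᴮ-lower {π = π} {σ} {0} π≤σ (λ {k} _ → BlockSwap-upper (BlockSwap-flip (shape-σ k))) z≤n)))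

      c′≤c : a′ + suc w′ + suc z′ ≤ a + suc w + suc z
      c′≤c = subst (_≤ a + suc w + suc z) (sym (+-suc (a′ + suc w′) z′)) (≰⇒> λ c≤k → contradiction
        (≤-trans (≤ᴮ-lower {π = π} {σ} {t = 0} π≤σ
            (λ {k} c≤k → ≤-trans (≤-reflexive (sym (shape-entry {ω = σ} shape-σ (high c≤k refl)))) (m≤m+n _ 0)) c≤k)
          (≤-reflexive (trans (+-identityʳ _) (shape-entry {ω = π} shape-π
            (down (m≤m+n a′ z′) (+-monoʳ-< a′ (n<1+n z′)) (lemma a′ w′ z′))))))
        (<⇒≱ (+-monoˡ-< z′ (m<m+n a′ (s≤s z≤n)))))
        where
        lemma : ∀ a w z → a + suc w + z ≡ a + z + suc w
        lemma = solve-∀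

  -- Codes: comparable pairs, existence and uniqueness.

  private
    m≤n⇒∃[o]o+m≡n : ∀ {m n} → m ≤ n → ∃ λ o → o + m ≡ n
    m≤n⇒∃[o]o+m≡n {m} m≤n with o , eq ← m≤n⇒∃[o]m+o≡n m≤n = o , trans (+-comm o m) eq

  code-total : ∀ a z w b → a + suc w + suc z + b ≡ 2 + (a + (z + (w + (b + 0))))
  code-total = solve-∀

  private
    balance₁ : ∀ a z w b ζ β x μ →
      sum (x + ζ + a ∷ z ∷ w ∷ β + b ∷ []) ≡ sum (a ∷ ζ + z ∷ μ + w ∷ b ∷ []) → β + x ≡ μ
    balance₁ a z w b ζ β x μ eq = +-cancelˡ-≡ (ζ + (a + z + w + b)) (β + x) μ
      (trans (lhs a z w b ζ β x) (trans eq (rhs a z w b ζ μ)))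
      where
      lhs : ∀ a z w b ζ β x → ζ + (a + z + w + b) + (β + x) ≡ (x + ζ + a) + (z + (w + (β + b + 0)))
      lhs = solve-∀
      rhs : ∀ a z w b ζ μ → a + (ζ + z + (μ + w + (b + 0))) ≡ ζ + (a + z + w + b) + μ
      rhs = solve-∀

    balance₂ : ∀ a z w b α β x μ →
      sum (α + a ∷ z ∷ w ∷ β + b ∷ []) ≡ sum (a ∷ suc α + x + z ∷ μ + w ∷ b ∷ []) → β ≡ suc x + μ
    balance₂ a z w b α β x μ eq = +-cancelˡ-≡ (α + (a + z + w + b)) β (suc x + μ)
      (trans (lhs a z w b α β) (trans eq (rhs a z w b α x μ)))
      where
      lhs : ∀ a z w b α β → α + (a + z + w + b) + β ≡ (α + a) + (z + (w + (β + b + 0)))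
      lhs = solve-∀
      rhs : ∀ a z w b α x μ →
        a + (suc α + x + z + (μ + w + (b + 0))) ≡ α + (a + z + w + b) + (suc x + μ)
      rhs = solve-∀

    total₁ : ∀ a z w b ζ β x →
      a + (z + (w + (b + (ζ + (β + (x + 0)))))) ≡ a + (ζ + z + (β + x + w + (b + 0)))
    total₁ = solve-∀

    total₂ : ∀ a z w b α μ x →
      suc (a + (z + (w + (b + (α + (μ + (x + 0))))))) ≡ a + (suc α + x + z + (μ + w + (b + 0)))
    total₂ = solve-∀

    regroup : ∀ α x z → α + (suc x + z) ≡ suc α + x + z
    regroup = solve-∀

  IsPair : ℕ → Code → Code → Set
  IsPair m q′ q = (∃ λ t → sum t ≡ m × pair₁ t ≡ (q′ , q)) ⊎
                  (∃ λ t → suc (sum t) ≡ m × pair₂ t ≡ (q′ , q))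

  pair-exists : ∀ {m a z w b a′ z′ w′ b′} →
    sum (a′ ∷ z′ ∷ w′ ∷ b′ ∷ []) ≡ m → sum (a ∷ z ∷ w ∷ b ∷ []) ≡ m →
    a ≤ a′ × z′ ≤ z × w′ ≤ w × a′ + suc w′ + suc z′ ≤ a + suc w + suc z →
    IsPair m (a′ ∷ z′ ∷ w′ ∷ b′ ∷ []) (a ∷ z ∷ w ∷ b ∷ [])
  pair-exists {a = a} {z} {w} {b} {a′} {z′} {w′} {b′} sum-q′ refl (a≤a′ , z′≤z , w′≤w , c′≤c)
    -- As both codes have the same total, the comparison of the ends `c′ ≤ c` turns into `b ≤ b′`.
    with β , refl ← m≤n⇒∃[o]o+m≡n (+-cancelˡ-≤ (a + suc w + suc z) b b′ (≤-trans
           (≤-reflexive (trans (code-total a z w b) (trans (cong (2 +_) (sym sum-q′)) (sym (code-total a′ z′ w′ b′)))))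
           (+-monoˡ-≤ b′ c′≤c)))
    with α , refl ← m≤n⇒∃[o]o+m≡n a≤a′
       | ζ , refl ← m≤n⇒∃[o]o+m≡n z′≤z
       | μ , refl ← m≤n⇒∃[o]o+m≡n w′≤w
    with ζ ≤? α
  ... | yes ζ≤α with x , refl ← m≤n⇒∃[o]o+m≡n ζ≤α
                with refl ← balance₁ a z′ w′ b ζ β x μ sum-q′ =
    inj₁ ((a ∷ z′ ∷ w′ ∷ b ∷ ζ ∷ β ∷ x ∷ []) , total₁ a z′ w′ b ζ β x ,
      cong₂ _,_ (cong (_∷ z′ ∷ w′ ∷ β + b ∷ []) (sym (+-assoc x ζ a)))
        (cong (λ w → a ∷ ζ + z′ ∷ w ∷ b ∷ []) (sym (+-assoc β x w′))))
  ... | no ζ≰α with x , refl ← m≤n⇒∃[o]m+o≡n (≰⇒> ζ≰α)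
               with refl ← balance₂ a z′ w′ b α β x μ sum-q′ =
    inj₂ ((a ∷ z′ ∷ w′ ∷ b ∷ α ∷ μ ∷ x ∷ []) , total₂ a z′ w′ b α μ x ,
      cong₂ _,_ (cong (λ b → α + a ∷ z′ ∷ w′ ∷ b ∷ []) (sym (+-assoc (suc x) μ b)))
        (cong (λ z → a ∷ z ∷ μ + w′ ∷ b ∷ []) (regroup α x z′)))

  module _ {n a : ℕ} where

    private
      Image : ∀ z w → Fin n → Set
      Image z w i = ∃ λ (j : Fin n) → BlockSwap a z w (toℕ i) (toℕ j)

      value-bound : ∀ {z w i v} → a + w + z ≤ n → i < n → BlockSwap a z w i v → v < n
      value-bound c≤n i<n (low _ refl)    = i<n
      value-bound c≤n i<n (up _ i<b refl) = <-≤-trans (+-monoˡ-< _ i<b) c≤n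
      value-bound c≤n i<n (down _ _ refl) = ≤-<-trans (m≤m+n _ _) i<n
      value-bound c≤n i<n (high _ refl)   = i<n

      image : ∀ z w → a + w + z ≤ n → ∀ i → Image z w i
      image z w c≤n i with v , p ← BlockSwap-total a z w (toℕ i)
        with v<n ← value-bound c≤n (Fin.toℕ<n i) p =
        fromℕ< v<n , subst (BlockSwap a z w (toℕ i)) (sym (Fin.toℕ-fromℕ< v<n)) p

    -- The inverse is the block swap with `z` and `w` exchanged; both round trips are instances of
    -- `BlockSwap-functional`.
    shape-exists : ∀ {z w} → a + w + z ≤ n → ∃ λ (ω : Permutation′ n) → Shape ω a z w
    shape-exists {z} {w} c≤n = ω , shape
      where
      to-image : ∀ i → Image z w i
      to-image = image z w c≤n

      from-image : ∀ i → Image w z i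
      from-image = image w z (subst (_≤ n) (lemma a z w) c≤n)
        where
        lemma : ∀ a z w → a + w + z ≡ a + z + w
        lemma = solve-∀

      ω : Permutation′ n
      ω = permutation (proj₁ ∘ to-image) (proj₁ ∘ from-image)
        (λ i → Fin.toℕ-injective
          (BlockSwap-functional (proj₂ (to-image (proj₁ (from-image i)))) (BlockSwap-flip (proj₂ (from-image i)))))
        (λ i → Fin.toℕ-injective
          (BlockSwap-functional (proj₂ (from-image (proj₁ (to-image i)))) (BlockSwap-flip (proj₂ (to-image i)))))

      shape-at : ∀ {i} → InFin n i → BlockSwap a z w i (entry ω i)
      shape-at (inside j)    = subst (BlockSwap a z w _) (sym (entry-toℕ ω j)) (proj₂ (to-image j))
      shape-at (outside n≤i) = high (≤-trans c≤n n≤i) (entry-≥ ω n≤i)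

      shape : Shape ω a z w
      shape i = shape-at (inFin n i)

  module _ {m : ℕ} where

    code-exists : ∀ q → sum q ≡ m → ∃ λ (ω : Permutation′ (2 + m)) → Represents ω q
    code-exists (a ∷ z ∷ w ∷ b ∷ []) sum-q = shape-exists
      (m+n≤o⇒m≤o _ (≤-reflexive (trans (code-total a z w b) (cong (2 +_) sum-q))))

    shape⇒code : ∀ {ω : Permutation′ (2 + m)} {a z w} → Shape ω a (suc z) (suc w) →
                 ∃ λ q → sum q ≡ m × Represents ω q
    shape⇒code {ω} {a} {z} {w} shape with b , eq ← m≤n⇒∃[o]m+o≡n (shape-bound {ω = ω} shape) =
      a ∷ z ∷ w ∷ b ∷ [] , suc-injective (suc-injective (trans (sym (code-total a z w b)) eq)) , shape

    -- Reading `ω ≤ᴮ ω` with the two codes in either order gives all inequalities both ways. The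
    -- last entry, invisible to `Represents`, follows from the sum.
    code-unique : ∀ {ω : Permutation′ (2 + m)} {q q′} → sum q ≡ m → sum q′ ≡ m →
                  Represents ω q → Represents ω q′ → q ≡ q′
    code-unique {ω} {a ∷ z ∷ w ∷ b ∷ []} {a′ ∷ z′ ∷ w′ ∷ b′ ∷ []} refl sum-q′ shape shape′
      with a≤a′ , z′≤z , w′≤w , _ ← ≤ᴮ⇒blocks {π = ω} {ω} shape′ shape (≤ᴮ-reflexive {π = ω} {ω} λ _ → refl)
         | a′≤a , z≤z′ , w≤w′ , _ ← ≤ᴮ⇒blocks {π = ω} {ω} shape shape′ (≤ᴮ-reflexive {π = ω} {ω} λ _ → refl)
      with refl ← ≤-antisym a≤a′ a′≤a | refl ← ≤-antisym z≤z′ z′≤z | refl ← ≤-antisym w≤w′ w′≤w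
      with refl ← +-cancelʳ-≡ 0 b′ b (+-cancelˡ-≡ w _ _ (+-cancelˡ-≡ z _ _ (+-cancelˡ-≡ a _ _ sum-q′))) = refl

    ≤ᴮ⇒pair : ∀ {π σ : Permutation′ (2 + m)} {q′ q} → sum q′ ≡ m → sum q ≡ m →
      Represents π q′ → Represents σ q → π ≤ᴮ σ → IsPair m q′ q
    ≤ᴮ⇒pair {π} {σ} {a′ ∷ z′ ∷ w′ ∷ b′ ∷ []} {a ∷ z ∷ w ∷ b ∷ []} sum-q′ sum-q rep-π rep-σ π≤σ =
      pair-exists sum-q′ sum-q (≤ᴮ⇒blocks {π = π} {σ} rep-π rep-σ π≤σ)

    IsPair⇒≤ᴮ : ∀ {π σ : Permutation′ (2 + m)} {q′ q} → IsPair m q′ q →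
      Represents π q′ → Represents σ q → π ≤ᴮ σ
    IsPair⇒≤ᴮ {π} {σ} (inj₁ (t , _ , refl)) = pair₁-≤ᴮ {π = π} {σ} t
    IsPair⇒≤ᴮ {π} {σ} (inj₂ (t , _ , refl)) = pair₂-≤ᴮ {π = π} {σ} t

    ≤ᴮ-antisym : ∀ {π σ : Permutation′ (2 + m)} {q′ q} → sum q′ ≡ m → sum q ≡ m →
      Represents π q′ → Represents σ q → π ≤ᴮ σ → σ ≤ᴮ π → π ≈ σ
    ≤ᴮ-antisym {π} {σ} {a′ ∷ z′ ∷ w′ ∷ b′ ∷ []} {a ∷ z ∷ w ∷ b ∷ []} sum-q′ sum-q shape-π shape-σ π≤σ σ≤π
      with a≤a′ , z′≤z , w′≤w , _ ← ≤ᴮ⇒blocks {π = π} {σ} shape-π shape-σ π≤σ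
         | a′≤a , z≤z′ , w≤w′ , _ ← ≤ᴮ⇒blocks {π = σ} {π} shape-σ shape-π σ≤π
      with refl ← ≤-antisym a≤a′ a′≤a | refl ← ≤-antisym z≤z′ z′≤z | refl ← ≤-antisym w≤w′ w′≤w =
      shape-unique {π = π} {σ} shape-π shape-σ

  -- Descents on `Fin n`, descents on ℕ, and shapes.

  module _ {n : ℕ} where

    -- The continuation creates no descent: the last genuine entry is below `n`, and from `n` on the
    -- identity rises.
    ∃!-descent⇒OnlyDescent : ∀ {ω : Permutation′ n} → ∃! _≡_ (Descent ω) → ∃ (OnlyDescent (entry ω))
    ∃!-descent⇒OnlyDescent {ω} (d , (j , j≡1+d , ωj<ωd) , unique) = toℕ d ,
      subst₂ _<_ (trans (sym (entry-toℕ ω j)) (cong (entry ω) j≡1+d)) (sym (entry-toℕ ω d)) ωj<ωd ,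
      rises
      where
      rises : ∀ {i} → i ≢ toℕ d → entry ω i < entry ω (suc i)
      rises {i} i≢d with <-≤-connex (suc i) n
      ... | inj₂ n≤1+i with inFin n i
      ...   | outside n≤i rewrite entry-≥ ω n≤i | entry-≥ ω (m≤n⇒m≤1+n n≤i) = n<1+n i
      ...   | inside k rewrite entry-≥ ω n≤1+i = <-≤-trans (entry-< ω (Fin.toℕ<n k)) n≤1+i
      rises {i} i≢d | inj₁ 1+i<n with <-cmp (entry ω i) (entry ω (suc i))
      ... | tri< lt _ _ = lt
      ... | tri≈ _ eq _ = contradiction (entry-injective ω eq) (<⇒≢ (n<1+n i))
      ... | tri> _ _ gt = contradiction (trans (sym at-i) (cong toℕ (sym (unique descent)))) i≢d
        where
        k = fromℕ< (<⇒≤ 1+i<n)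
        l = fromℕ< 1+i<n
        at-i : toℕ k ≡ i
        at-i = Fin.toℕ-fromℕ< (<⇒≤ 1+i<n)
        at-1+i : toℕ l ≡ suc i
        at-1+i = Fin.toℕ-fromℕ< 1+i<n
        descent : Descent ω k
        descent = l , trans at-1+i (cong suc (sym at-i)) , subst₂ _<_
          (trans (cong (entry ω) (sym at-1+i)) (entry-toℕ ω l))
          (trans (cong (entry ω) (sym at-i)) (entry-toℕ ω k)) gt

    OnlyDescent⇒∃!-descent : ∀ {ω : Permutation′ n} {d} → OnlyDescent (entry ω) d →
      ∃! _≡_ (Descent ω)
    OnlyDescent⇒∃!-descent {ω} {d} (falls , rises) with inFin n d
    ... | outside n≤d = contradiction
      (subst₂ _<_ (entry-≥ ω (m≤n⇒m≤1+n n≤d)) (entry-≥ ω n≤d) falls) (<-asym (n<1+n d))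
    ... | inside k with <-≤-connex (suc (toℕ k)) n
    ...   | inj₂ n≤1+i = contradiction falls
      (<⇒≯ (subst (entry ω (toℕ k) <_) (sym (entry-≥ ω n≤1+i)) (<-≤-trans (entry-< ω (Fin.toℕ<n k)) n≤1+i)))
    ...   | inj₁ 1+i<n = k ,
      (l , at-1+i , subst₂ _<_ (trans (cong (entry ω) (sym at-1+i)) (entry-toℕ ω l)) (entry-toℕ ω k) falls) ,
      unique
      where
      l = fromℕ< 1+i<n
      at-1+i : toℕ l ≡ suc (toℕ k)
      at-1+i = Fin.toℕ-fromℕ< 1+i<n
      unique : ∀ {i} → Descent ω i → k ≡ i
      unique {i} (j , j≡1+i , ωj<ωi) with toℕ i ≟ toℕ k
      ... | yes i≡k = Fin.toℕ-injective (sym i≡k)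
      ... | no i≢k = contradiction ωj<ωi (<⇒≯ (subst₂ _<_ (entry-toℕ ω i)
        (trans (cong (entry ω) (sym j≡1+i)) (entry-toℕ ω j)) (rises i≢k)))

    -- The first block has `suc w` entries, so `a + w` is its last position. A descent is an
    -- inversion of adjacent positions, and `BlockSwap-inversion` makes it straddle the end of that
    -- block.
    shape⇒OnlyDescent : ∀ {ω : Permutation′ n} {a z w} → Shape ω a (suc z) (suc w) →
      OnlyDescent (entry ω) (a + w)
    shape⇒OnlyDescent {ω} {a} {z} {w} shape = falls , rises
      where
      falls : entry ω (suc (a + w)) < entry ω (a + w)
      falls = subst₂ _<_
        (sym (shape-entry {ω = ω} shape (down ≤-refl (m<m+n a (s≤s z≤n)) (sym (+-suc a w)))))
        (sym (shape-entry {ω = ω} shape (up (m≤m+n a w) (+-monoʳ-< a (n<1+n w)) refl)))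
        (≤-<-trans (m≤m+n a w) (m<m+n (a + w) (s≤s z≤n)))

      rises : ∀ {i} → i ≢ a + w → entry ω i < entry ω (suc i)
      rises {i} i≢d with <-cmp (entry ω i) (entry ω (suc i))
      ... | tri< lt _ _ = lt
      ... | tri≈ _ eq _ = contradiction (entry-injective ω eq) (<⇒≢ (n<1+n i))
      ... | tri> _ _ gt with i<b , b≤1+i ← BlockSwap-inversion (shape i) (shape (suc i)) (n<1+n i) gt =
        contradiction (suc-injective (trans (≤-antisym i<b b≤1+i) (+-suc a w))) i≢d

    shape⇒Bigrassmannian : ∀ {ω : Permutation′ n} {a z w} → Shape ω a (suc z) (suc w) →
      Bigrassmannian ω
    shape⇒Bigrassmannian {ω} shape =
      OnlyDescent⇒∃!-descent {ω} (shape⇒OnlyDescent {ω} shape) ,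
      OnlyDescent⇒∃!-descent {flip ω} (shape⇒OnlyDescent {flip ω} (shape-flip {ω = ω} shape))

  Bigrassmannian⇒code : ∀ {m} {ω : Permutation′ (2 + m)} → Bigrassmannian ω → ∃ λ q →
    sum q ≡ m × Represents ω q
  Bigrassmannian⇒code {ω = ω} (d , e)
    with _ , ↓ω ← ∃!-descent⇒OnlyDescent {ω = ω} d
       | _ , ↓ω⁻¹ ← ∃!-descent⇒OnlyDescent {ω = flip ω} e
    with a , z , w , shape ← classify {entry ω} {entry (flip ω)} (entry-flip (flip ω)) (entry-flip ω)
           ↓ω ↓ω⁻¹ (entry-≥ ω) = shape⇒code {ω = ω} shape

  code⇒Bigrassmannian : ∀ {n} {ω : Permutation′ n} {q} → Represents ω q → Bigrassmannian ω
  code⇒Bigrassmannian {ω = ω} {a ∷ z ∷ w ∷ b ∷ []} shape = shape⇒Bigrassmannian {ω = ω} shape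

-- Counting

module _ where
  open import Data.Fin.Permutation using (Permutation′; _≈_)
  open import Data.List.Base using (List; []; _∷_; _++_; map; length; filter; cartesianProduct)
  open import Data.List.Membership.Propositional using (_∈_)
  open import Data.List.Membership.Propositional.Properties
    using (∈-++⁺ˡ; ∈-++⁺ʳ; ∈-map⁺; ∈-map⁻; ∈-filter⁺; ∈-filter⁻; ∈-cartesianProduct⁺; ∈-cartesianProduct⁻)
  import Data.List.Membership.Setoid as Membership
  import Data.List.Membership.Setoid.Properties as Membershipₛ
  open import Data.List.Properties using (length-++; length-map; length-removeAt′)
  open import Data.List.Relation.Unary.All as All using (All; []; _∷_)
  import Data.List.Relation.Unary.All.Properties as All
  open import Data.List.Relation.Unary.AllPairs as AllPairs using (AllPairs; []; _∷_)
  open import Data.List.Relation.Unary.Any as Any using (Any; here; there; _─_)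
  open import Data.List.Relation.Unary.Unique.Propositional using (Unique)
  import Data.List.Relation.Unary.Unique.Propositional.Properties as Unique
  import Data.List.Relation.Unary.Unique.Setoid as Uniqueₛ
  import Data.List.Relation.Unary.Unique.Setoid.Properties as Uniqueₛ
  open import Data.Nat.Base
  open import Data.Nat.Properties
  open import Data.Nat.Tactic.RingSolver using (solve-∀)
  open import Data.Product using (proj₁; proj₂; swap)
  open import Data.Product.Relation.Binary.Pointwise.NonDependent using (_×ₛ_)
  open import Data.Sum.Base using (_⊎_; inj₁; inj₂)
  open import Data.Vec.Base using (Vec; []; _∷_; sum)
  open import Function.Base using (_∘_)
  open import Level using (0ℓ)
  open import Relation.Nullary.Decidable using (yes; no; _×-dec_; _⊎-dec_)
  open import Relation.Nullary.Negation using (¬_; contradiction)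
  open import Relation.Unary using (Pred; Decidable)

  -- Comparing and combining cardinalities.

  module _ {A B : Set} where

    private
      any-─ : ∀ {P Q : Pred B 0ℓ} {ys} → (∀ y → P y → ¬ Q y) → (p : Any P ys) → Any Q ys →
        Any Q (ys ─ p)
      any-─ disjoint (here py)  (here qy)  = contradiction qy (disjoint _ py)
      any-─ disjoint (here py)  (there q)  = q
      any-─ disjoint (there p)  (here qy)  = here qy
      any-─ disjoint (there p)  (there q)  = there (any-─ disjoint p q)

    -- A pigeonhole argument: the partner of the first `x` is removed from `ys`, and by disjointness
    -- no later `x` loses its own partner.
    length-≤ : ∀ (R : A → B → Set) {xs ys} →
      AllPairs (λ x x′ → ∀ y → R x y → ¬ R x′ y) xs → All (λ x → Any (R x) ys) xs → length xs ≤ length ys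
    length-≤ R                   []       []       = z≤n
    length-≤ R {x ∷ xs} {ys} (d ∷ ds) (p ∷ ps) = begin
      suc (length xs)       ≤⟨ s≤s (length-≤ R ds (All.zipWith (λ (d , q) → any-─ d p q) (d , ps))) ⟩
      suc (length (ys ─ p)) ≡⟨ length-removeAt′ ys (Any.index p) ⟨
      length ys             ∎
      where open ≤-Reasoning

  module _ {A : Set} {P Q : Pred A 0ℓ} (P? : Decidable P) (Q? : Decidable Q) where

    length-filter-∪∩ : ∀ xs →
      length (filter (λ x → P? x ⊎-dec Q? x) xs) + length (filter (λ x → P? x ×-dec Q? x) xs) ≡
      length (filter P? xs) + length (filter Q? xs)
    length-filter-∪∩ []       = refl
    length-filter-∪∩ (x ∷ xs) with P? x | Q? x
    ... | yes _ | yes _ = cong suc (trans (+-suc _ _) (trans (cong suc (length-filter-∪∩ xs)) (sym (+-suc _ _))))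
    ... | yes _ | no _  = cong suc (length-filter-∪∩ xs)
    ... | no _  | yes _ = trans (cong suc (length-filter-∪∩ xs)) (sym (+-suc _ _))
    ... | no _  | no _  = length-filter-∪∩ xs

  -- Weak compositions.

  incrementHead : ∀ {k} → Vec ℕ (suc k) → Vec ℕ (suc k)
  incrementHead (x ∷ xs) = suc x ∷ xs

  weakCompositions : ∀ k → ℕ → List (Vec ℕ k)
  weakCompositions zero    zero    = [] ∷ []
  weakCompositions zero    (suc m) = []
  weakCompositions (suc k) zero    = map (0 ∷_) (weakCompositions k zero)
  weakCompositions (suc k) (suc m) =
    map (0 ∷_) (weakCompositions k (suc m)) ++ map incrementHead (weakCompositions (suc k) m)

  weakCompositions-complete : ∀ {k m} (v : Vec ℕ k) → sum v ≡ m → v ∈ weakCompositions k m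
  weakCompositions-complete {zero}  {zero}  []          refl = here refl
  weakCompositions-complete {suc k} {zero}  (zero ∷ v)  eq   = ∈-map⁺ (0 ∷_) (weakCompositions-complete v eq)
  weakCompositions-complete {suc k} {suc m} (zero ∷ v)  eq   =
    ∈-++⁺ˡ (∈-map⁺ (0 ∷_) (weakCompositions-complete v eq))
  weakCompositions-complete {suc k} {suc m} (suc x ∷ v) eq   =
    ∈-++⁺ʳ _ (∈-map⁺ incrementHead (weakCompositions-complete (x ∷ v) (suc-injective eq)))

  weakCompositions-sound : ∀ k m → All (λ v → sum v ≡ m) (weakCompositions k m)
  weakCompositions-sound zero    zero    = refl ∷ []
  weakCompositions-sound zero    (suc m) = []
  weakCompositions-sound (suc k) zero    = All.map⁺ (weakCompositions-sound k zero)
  weakCompositions-sound (suc k) (suc m) = All.++⁺ (All.map⁺ (weakCompositions-sound k (suc m)))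
    (All.map⁺ (All.map (λ { {_ ∷ _} eq → cong suc eq }) (weakCompositions-sound (suc k) m)))

  weakCompositions-unique : ∀ k m → Unique (weakCompositions k m)
  weakCompositions-unique zero    zero    = [] ∷ []
  weakCompositions-unique zero    (suc m) = []
  weakCompositions-unique (suc k) zero    = Unique.map⁺ (λ { refl → refl }) (weakCompositions-unique k zero)
  weakCompositions-unique (suc k) (suc m) = Unique.++⁺
    (Unique.map⁺ (λ { refl → refl }) (weakCompositions-unique k (suc m)))
    (Unique.map⁺ (λ { {_ ∷ _} {_ ∷ _} refl → refl }) (weakCompositions-unique (suc k) m))
    disjoint
    where
    disjoint : ∀ {v} → ¬ (v ∈ map (0 ∷_) (weakCompositions k (suc m)) ×
                          v ∈ map incrementHead (weakCompositions (suc k) m))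
    disjoint (p , q) with ∈-map⁻ (0 ∷_) p | ∈-map⁻ incrementHead q
    ... | _ , _ , refl | _ ∷ _ , _ , ()

  -- The rising factorial `(m + 1)(m + 2) ⋯ (m + k)`.
  rising : ℕ → ℕ → ℕ
  rising zero    m = 1
  rising (suc k) m = suc m * rising k (suc m)

  rising-last : ∀ k m → rising (suc k) m ≡ rising k m * (m + suc k)
  rising-last zero    m = lemma m
    where
    lemma : ∀ m → suc m * 1 ≡ 1 * (m + 1)
    lemma = solve-∀
  rising-last (suc k) m = begin
    suc m * rising (suc k) (suc m)              ≡⟨ cong (suc m *_) (rising-last k (suc m)) ⟩
    suc m * (rising k (suc m) * (suc m + suc k)) ≡⟨ *-assoc (suc m) (rising k (suc m)) _ ⟨
    suc m * rising k (suc m) * (suc m + suc k)  ≡⟨ cong (rising (suc k) m *_) (+-suc m (suc k)) ⟨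
    rising (suc k) m * (m + suc (suc k))        ∎
    where open ≡-Reasoning

  -- The binomial coefficient `(m + k)` over `k`, freed of division. In Pascal's rule the two
  -- summands become `suc k` and `suc m` times the common factor `rising k (suc m)`.
  length-weakCompositions : ∀ k m → k ! * length (weakCompositions (suc k) m) ≡ rising k m
  length-weakCompositions zero zero    = refl
  length-weakCompositions zero (suc m) =
    trans (cong (1 *_) (length-map incrementHead (weakCompositions 1 m))) (length-weakCompositions zero m)
  length-weakCompositions (suc k) zero = begin
    suc k * k ! * length (map (0 ∷_) (weakCompositions (suc k) 0))
      ≡⟨ cong (suc k * k ! *_) (length-map (0 ∷_) (weakCompositions (suc k) 0)) ⟩
    suc k * k ! * length (weakCompositions (suc k) 0)
      ≡⟨ *-assoc (suc k) (k !) _ ⟩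
    suc k * (k ! * length (weakCompositions (suc k) 0))
      ≡⟨ cong (suc k *_) (length-weakCompositions k 0) ⟩
    suc k * rising k 0
      ≡⟨ *-comm (suc k) _ ⟩
    rising k 0 * suc k
      ≡⟨ rising-last k 0 ⟨
    rising (suc k) 0 ∎
    where open ≡-Reasoning
  length-weakCompositions (suc k) (suc m) = begin
    suc k * k ! * length (map (0 ∷_) (weakCompositions (suc k) (suc m)) ++
                          map incrementHead (weakCompositions (suc (suc k)) m))
      ≡⟨ cong (suc k * k ! *_) (trans (length-++ (map (0 ∷_) (weakCompositions (suc k) (suc m))))
           (cong₂ _+_ (length-map (0 ∷_) (weakCompositions (suc k) (suc m)))
                      (length-map incrementHead (weakCompositions (suc (suc k)) m)))) ⟩
    suc k * k ! * (L₁ + L₂)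
      ≡⟨ expand k (k !) L₁ L₂ ⟩
    suc k * (k ! * L₁) + suc k ! * L₂
      ≡⟨ cong₂ _+_ (cong (suc k *_) (length-weakCompositions k (suc m))) (length-weakCompositions (suc k) m) ⟩
    suc k * rising k (suc m) + suc m * rising k (suc m)
      ≡⟨ collect k m (rising k (suc m)) ⟩
    rising k (suc m) * (suc m + suc k)
      ≡⟨ rising-last k (suc m) ⟨
    rising (suc k) (suc m) ∎
    where
    open ≡-Reasoning
    L₁ = length (weakCompositions (suc k) (suc m))
    L₂ = length (weakCompositions (suc (suc k)) m)
    expand : ∀ k f x y → suc k * f * (x + y) ≡ suc k * (f * x) + suc k * f * y
    expand = solve-∀
    collect : ∀ k m r → suc k * r + suc m * r ≡ r * (suc m + suc k)
    collect = solve-∀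

  -- The list of comparable pairs of codes.

  pairs : ℕ → List (Code × Code)
  pairs zero    = map pair₁ (weakCompositions 7 zero)
  pairs (suc m) = map pair₁ (weakCompositions 7 (suc m)) ++ map pair₂ (weakCompositions 7 m)

  pairs-complete : ∀ {m q′ q} → IsPair m q′ q → (q′ , q) ∈ pairs m
  pairs-complete {zero}  (inj₁ (t , sum-t , refl)) = ∈-map⁺ pair₁ (weakCompositions-complete t sum-t)
  pairs-complete {suc m} (inj₁ (t , sum-t , refl)) =
    ∈-++⁺ˡ (∈-map⁺ pair₁ (weakCompositions-complete t sum-t))
  pairs-complete {suc m} (inj₂ (t , sum-t , refl)) =
    ∈-++⁺ʳ _ (∈-map⁺ pair₂ (weakCompositions-complete t (suc-injective sum-t)))

  pairs-sound : ∀ m → All (λ (q′ , q) → IsPair m q′ q) (pairs m)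
  pairs-sound zero    = All.map⁺ {f = pair₁}
    (All.map (λ {t} sum-t → inj₁ (t , sum-t , refl)) (weakCompositions-sound 7 0))
  pairs-sound (suc m) = All.++⁺
    (All.map⁺ (All.map (λ {t} sum-t → inj₁ (t , sum-t , refl)) (weakCompositions-sound 7 (suc m))))
    (All.map⁺ (All.map (λ {t} sum-t → inj₂ (t , cong suc sum-t , refl)) (weakCompositions-sound 7 m)))

  private
    coordinates : ∀ {a z w b a′ z′ w′ b′} →
      _≡_ {A = Code} (a ∷ z ∷ w ∷ b ∷ []) (a′ ∷ z′ ∷ w′ ∷ b′ ∷ []) →
                  a ≡ a′ × z ≡ z′ × w ≡ w′ × b ≡ b′
    coordinates refl = refl , refl , refl , refl

  pair₁-injective : ∀ {t t′} → pair₁ t ≡ pair₁ t′ → t ≡ t′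
  pair₁-injective {a ∷ z ∷ w ∷ b ∷ ζ ∷ β ∷ x ∷ []} {a′ ∷ z′ ∷ w′ ∷ b′ ∷ ζ′ ∷ β′ ∷ x′ ∷ []} eq
    with α-eq , refl , refl , β-eq ← coordinates (cong proj₁ eq)
       | refl , ζ-eq , μ-eq , refl ← coordinates (cong proj₂ eq)
    with refl ← +-cancelʳ-≡ z ζ ζ′ ζ-eq | refl ← +-cancelʳ-≡ b β β′ β-eq
    with refl ← +-cancelʳ-≡ (ζ + a) x x′ α-eq = refl

  pair₂-injective : ∀ {t t′} → pair₂ t ≡ pair₂ t′ → t ≡ t′
  pair₂-injective {a ∷ z ∷ w ∷ b ∷ α ∷ μ ∷ x ∷ []} {a′ ∷ z′ ∷ w′ ∷ b′ ∷ α′ ∷ μ′ ∷ x′ ∷ []} eq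
    with α-eq , refl , refl , β-eq ← coordinates (cong proj₁ eq)
       | refl , ζ-eq , μ-eq , refl ← coordinates (cong proj₂ eq)
    with refl ← +-cancelʳ-≡ a α α′ α-eq | refl ← +-cancelʳ-≡ w μ μ′ μ-eq
    with refl ← +-cancelʳ-≡ (μ + b) x x′ (suc-injective β-eq) = refl

  -- The gain in `a` is at least the loss in `z` for `pair₁`, and strictly less for `pair₂`.
  pair₁≢pair₂ : ∀ {t t′} → pair₁ t ≢ pair₂ t′
  pair₁≢pair₂ {a ∷ z ∷ w ∷ b ∷ ζ ∷ β ∷ x ∷ []} {a′ ∷ z′ ∷ w′ ∷ b′ ∷ α ∷ μ ∷ x′ ∷ []} eq
    with α-eq , refl , refl , _ ← coordinates (cong proj₁ eq)
       | refl , ζ-eq , _ ← coordinates (cong proj₂ eq)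
    with refl ← +-cancelʳ-≡ z ζ (α + suc x′) (trans ζ-eq (sym (+-assoc α (suc x′) z))) =
    contradiction (+-cancelʳ-≡ a _ α (trans (+-assoc x (α + suc x′) a) α-eq))
      (>⇒≢ (<-≤-trans (m<m+n α (s≤s z≤n)) (m≤n+m (α + suc x′) x)))

  pairs-unique : ∀ m → Unique (pairs m)
  pairs-unique zero    = Unique.map⁺ pair₁-injective (weakCompositions-unique 7 0)
  pairs-unique (suc m) = Unique.++⁺
    (Unique.map⁺ pair₁-injective (weakCompositions-unique 7 (suc m)))
    (Unique.map⁺ pair₂-injective (weakCompositions-unique 7 m))
    disjoint
    where
    disjoint : ∀ {p} →
      ¬ (p ∈ map pair₁ (weakCompositions 7 (suc m)) × p ∈ map pair₂ (weakCompositions 7 m))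
    disjoint (p , q) with ∈-map⁻ pair₁ p | ∈-map⁻ pair₂ q
    ... | _ , _ , refl | _ , _ , eq = pair₁≢pair₂ eq

  IsPair⇒sums : ∀ {m q′ q} → IsPair m q′ q → sum q′ ≡ m × sum q ≡ m
  IsPair⇒sums (inj₁ ((a ∷ z ∷ w ∷ b ∷ ζ ∷ β ∷ x ∷ []) , refl , refl)) =
    lower a z w b ζ β x , upper a z w b ζ β x
    where
    lower : ∀ a z w b ζ β x →
      x + (ζ + a) + (z + (w + (β + b + 0))) ≡ a + (z + (w + (b + (ζ + (β + (x + 0))))))
    lower = solve-∀
    upper : ∀ a z w b ζ β x →
      a + (ζ + z + (β + (x + w) + (b + 0))) ≡ a + (z + (w + (b + (ζ + (β + (x + 0))))))
    upper = solve-∀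
  IsPair⇒sums (inj₂ ((a ∷ z ∷ w ∷ b ∷ α ∷ μ ∷ x ∷ []) , refl , refl)) =
    lower a z w b α μ x , upper a z w b α μ x
    where
    lower : ∀ a z w b α μ x →
      α + a + (z + (w + (suc x + (μ + b) + 0))) ≡ suc (a + (z + (w + (b + (α + (μ + (x + 0)))))))
    lower = solve-∀
    upper : ∀ a z w b α μ x →
      a + (α + (suc x + z) + (μ + w + (b + 0))) ≡ suc (a + (z + (w + (b + (α + (μ + (x + 0)))))))
    upper = solve-∀

  -- For positive `m`, `6! = 720` times the length is `rising 6 m + rising 6 (m - 1)`. Five factors
  -- are common, and the other two add up to `(m + 6) + m = 2 (m + 3)`: hence the square of `3 + m`,
  -- and 360 in place of 720.
  length-pairs : ∀ m → 360 * length (pairs m) ≡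
                       (1 + m) * (2 + m) * (3 + m) * (3 + m) * (4 + m) * (5 + m)
  length-pairs m = *-cancelˡ-≡ _ _ 2 (trans (sym (*-assoc 2 360 (length (pairs m)))) (doubled m))
    where
    open ≡-Reasoning
    doubled : ∀ m →
      720 * length (pairs m) ≡ 2 * ((1 + m) * (2 + m) * (3 + m) * (3 + m) * (4 + m) * (5 + m))
    doubled zero    = refl
    doubled (suc m) = begin
      720 * length (pairs (suc m))
        ≡⟨ cong (720 *_) (trans (length-++ (map pair₁ (weakCompositions 7 (suc m))))
             (cong₂ _+_ (length-map pair₁ (weakCompositions 7 (suc m))) (length-map pair₂ (weakCompositions 7 m)))) ⟩
      720 * (length (weakCompositions 7 (suc m)) + length (weakCompositions 7 m))
        ≡⟨ *-distribˡ-+ 720 (length (weakCompositions 7 (suc m))) _ ⟩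
      720 * length (weakCompositions 7 (suc m)) + 720 * length (weakCompositions 7 m)
        ≡⟨ cong₂ _+_ (length-weakCompositions 6 (suc m)) (length-weakCompositions 6 m) ⟩
      rising 6 (suc m) + rising 6 m
        ≡⟨ polynomial m ⟩
      2 * ((2 + m) * (3 + m) * (4 + m) * (4 + m) * (5 + m) * (6 + m)) ∎
      where
      polynomial : ∀ m →
        (2 + m) * ((3 + m) * ((4 + m) * ((5 + m) * ((6 + m) * ((7 + m) * 1))))) +
        (1 + m) * ((2 + m) * ((3 + m) * ((4 + m) * ((5 + m) * ((6 + m) * 1))))) ≡
        2 * ((2 + m) * (3 + m) * (4 + m) * (4 + m) * (5 + m) * (6 + m))
      polynomial = solve-∀

  length-codes : ∀ m → 6 * length (weakCompositions 4 m) ≡ (1 + m) * (2 + m) * (3 + m)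
  length-codes m = trans (length-weakCompositions 3 m) (polynomial m)
    where
    polynomial : ∀ m → (1 + m) * ((2 + m) * ((3 + m) * 1)) ≡ (1 + m) * (2 + m) * (3 + m)
    polynomial = solve-∀

  module _ {n : ℕ} where

    ≤ᴮ-resp-≈ : ∀ {π π′ σ σ′ : Permutation′ n} → π ≈ π′ → σ ≈ σ′ → π ≤ᴮ σ → π′ ≤ᴮ σ′
    ≤ᴮ-resp-≈ {π} {π′} {σ} {σ′} π≈π′ σ≈σ′ π≤σ =
      ≤ᴮ-trans {π = π′} {σ} {σ′}
        (≤ᴮ-trans {π = π′} {π} {σ} (≤ᴮ-reflexive {π = π′} {π} π≈π′) π≤σ)
        (≤ᴮ-reflexive {π = σ} {σ′} (sym ∘ σ≈σ′))

    represents-resp-≈ : ∀ {π σ : Permutation′ n} q → π ≈ σ → Represents π q → Represents σ q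
    represents-resp-≈ {π} {σ} (a ∷ z ∷ w ∷ b ∷ []) π≈σ shape i =
      subst (BlockSwap a (suc z) (suc w) i) (≈⇒entry {π = π} {σ} π≈σ i) (shape i)

    represents-unique : ∀ {π σ : Permutation′ n} q → Represents π q → Represents σ q → π ≈ σ
    represents-unique {π} {σ} (a ∷ z ∷ w ∷ b ∷ []) = shape-unique {π = π} {σ}

  module _ {A : Set} {P : A × A → Set} where

    swap-length : ∀ (P? : Decidable P) {xs} → Unique xs →
      length (filter P? (cartesianProduct xs xs)) ≤ length (filter (P? ∘ swap) (cartesianProduct xs xs))
    swap-length P? {xs} unique = length-≤ (λ p r → swap p ≡ r)
      (AllPairs.map (λ { p≢p′ _ refl refl → p≢p′ refl }) (Unique.filter⁺ P? (Unique.cartesianProduct⁺ unique unique)))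
      (All.tabulate λ p∈ → let p∈xs² , Pp = ∈-filter⁻ P? p∈ ; x∈ , y∈ = ∈-cartesianProduct⁻ xs xs p∈xs² in
        ∈-filter⁺ (P? ∘ swap) (∈-cartesianProduct⁺ y∈ x∈) Pp)

  -- Cardinalities for any irredundant, complete list of bigrassmannian permutations.

  module _ {m : ℕ} where

    private
      n = 2 + m
      S = ≈-setoid n
      open Membership S using () renaming (_∈_ to _∈ₛ_)

    module _ {xs : List (Permutation′ n)} (unique : Uniqueₛ.Unique S xs) (sound : All Bigrassmannian xs)
             (complete : ∀ {ω : Permutation′ n} → Bigrassmannian ω → ω ∈ₛ xs) where

      private
        xs² = cartesianProduct xs xs

        unique² : Uniqueₛ.Unique (S ×ₛ S) xs²
        unique² = Uniqueₛ.cartesianProduct⁺ S S unique unique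

        unique′ : Unique xs
        unique′ = AllPairs.map (λ { {π} ≉ refl → ≉ (λ _ → refl) }) unique

      length-bigrassmannians : length xs ≡ length (weakCompositions 4 m)
      length-bigrassmannians = ≤-antisym
        (length-≤ Represents
          (AllPairs.map (λ {π} {σ} π≉σ q rep-π rep-σ → π≉σ (represents-unique {π = π} {σ} q rep-π rep-σ)) unique)
          (All.map (λ {ω} bigrassmannian →
             let q , sum-q , rep = Bigrassmannian⇒code {ω = ω} bigrassmannian in
             Any.map (λ { refl → rep }) (weakCompositions-complete q sum-q)) sound))
        -- The sum belongs to the relation because `Represents` alone leaves the last entry of the
        -- code undetermined.
        (length-≤ (λ q ω → sum q ≡ m × Represents ω q)
          (AllPairs.map (λ {q} {q′} q≢q′ ω (sum-q , rep) (sum-q′ , rep′) →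
             q≢q′ (code-unique {ω = ω} {q} {q′} sum-q sum-q′ rep rep′)) (weakCompositions-unique 4 m))
          (All.map (λ {q} sum-q → let ω , rep = code-exists q sum-q in
             Any.map (λ {ω′} ω≈ω′ → sum-q , represents-resp-≈ {π = ω} {ω′} q ω≈ω′ rep)
               (complete {ω} (code⇒Bigrassmannian {ω = ω} {q} rep)))
             (weakCompositions-sound 4 m)))

      length-≤-pairs : length (filter (λ (π , σ) → π ≤ᴮ? σ) xs²) ≡ length (pairs m)
      length-≤-pairs = ≤-antisym
        (length-≤ (λ (π , σ) (q′ , q) → Represents π q′ × Represents σ q)
          (AllPairs.map (λ { {π , σ} {π′ , σ′} ≉ (q′ , q) (rep-π , rep-σ) (rep-π′ , rep-σ′) →
               ≉ (represents-unique {π = π} {π′} q′ rep-π rep-π′ , represents-unique {π = σ} {σ′} q rep-σ rep-σ′) })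
             (Uniqueₛ.filter⁺ (S ×ₛ S) (λ (π , σ) → π ≤ᴮ? σ) unique²))
          (All.tabulate λ { {π , σ} p∈ →
             let p∈xs² , π≤σ = ∈-filter⁻ (λ (π , σ) → π ≤ᴮ? σ) {xs = xs²} p∈
                 π∈ , σ∈ = ∈-cartesianProduct⁻ xs xs p∈xs²
                 q′ , sum-q′ , rep-π = Bigrassmannian⇒code {ω = π} (All.lookup sound π∈)
                 q , sum-q , rep-σ = Bigrassmannian⇒code {ω = σ} (All.lookup sound σ∈)
             in Any.map (λ { refl → rep-π , rep-σ })
                  (pairs-complete (≤ᴮ⇒pair {π = π} {σ} {q′} {q} sum-q′ sum-q rep-π rep-σ π≤σ)) }))
        (length-≤ (λ (q′ , q) (π , σ) → (sum q′ ≡ m × sum q ≡ m) × Represents π q′ × Represents σ q)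
          (AllPairs.map (λ { {q′ , q} {r′ , r} ≢ (π , σ) ((sum-q′ , sum-q) , rep-π , rep-σ)
                                                    ((sum-r′ , sum-r) , rep-π′ , rep-σ′) →
               ≢ (cong₂ _,_ (code-unique {ω = π} {q′} {r′} sum-q′ sum-r′ rep-π rep-π′)
                            (code-unique {ω = σ} {q} {r} sum-q sum-r rep-σ rep-σ′)) })
             (pairs-unique m))
          (All.map (λ { {q′ , q} isPair →
               let sum-q′ , sum-q = IsPair⇒sums {m} {q′} {q} isPair
                   π , rep-π = code-exists q′ sum-q′
                   σ , rep-σ = code-exists q sum-q
               in Any.map (λ { {π′ , σ′} (π≈π′ , σ≈σ′) → (sum-q′ , sum-q) ,
                      represents-resp-≈ {π = π} {π′} q′ π≈π′ rep-π , represents-resp-≈ {π = σ} {σ′} q σ≈σ′ rep-σ })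
                    (Membershipₛ.∈-filter⁺ (S ×ₛ S) (λ (π , σ) → π ≤ᴮ? σ)
                      (λ { {π , σ} {π′ , σ′} (π≈π′ , σ≈σ′) → ≤ᴮ-resp-≈ {π = π} {π′} {σ} {σ′} π≈π′ σ≈σ′ })
                      {v = π , σ} {xs²}
                      (Membershipₛ.∈-cartesianProduct⁺ S S {x = π} {σ}
                        (complete {π} (code⇒Bigrassmannian {ω = π} {q′} rep-π))
                        (complete {σ} (code⇒Bigrassmannian {ω = σ} {q} rep-σ)))
                      (IsPair⇒≤ᴮ {π = π} {σ} isPair rep-π rep-σ)) })
             (pairs-sound m)))

      private
        Below Above : Permutation′ n × Permutation′ n → Set
        Below (π , σ) = π ≤ᴮ σ
        Above (π , σ) = σ ≤ᴮ π

        below? : Decidable Below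
        below? (π , σ) = π ≤ᴮ? σ

        above? : Decidable Above
        above? (π , σ) = σ ≤ᴮ? π

        length-≥-pairs : length (filter above? xs²) ≡ length (pairs m)
        length-≥-pairs = trans
          (≤-antisym (swap-length {P = Above} above? unique′) (swap-length {P = Below} below? unique′))
          length-≤-pairs

        -- By antisymmetry these pairs are, up to `_≈_`, the diagonal; this is the correction term
        -- in the inclusion-exclusion.
        length-both : length (filter (λ p → below? p ×-dec above? p) xs²) ≡ length xs
        length-both = ≤-antisym
          (length-≤ (λ (π , σ) ω → π ≈ ω × σ ≈ ω)
            (AllPairs.map (λ { ≉ ω (π≈ω , σ≈ω) (π′≈ω , σ′≈ω) →
                 ≉ ((λ i → trans (π≈ω i) (sym (π′≈ω i))) , (λ i → trans (σ≈ω i) (sym (σ′≈ω i)))) })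
               (Uniqueₛ.filter⁺ (S ×ₛ S) {P = λ p → Below p × Above p} both? unique²))
            (All.tabulate λ { {π , σ} p∈ →
               let p∈xs² , π≤σ , σ≤π = ∈-filter⁻ both? {xs = xs²} p∈
                   π∈ , σ∈ = ∈-cartesianProduct⁻ xs xs p∈xs²
                   q′ , sum-q′ , rep-π = Bigrassmannian⇒code {ω = π} (All.lookup sound π∈)
                   q , sum-q , rep-σ = Bigrassmannian⇒code {ω = σ} (All.lookup sound σ∈)
                   π≈σ = ≤ᴮ-antisym {π = π} {σ} {q′} {q} sum-q′ sum-q rep-π rep-σ π≤σ σ≤π
               in Any.map (λ { refl → (λ _ → refl) , (λ i → sym (π≈σ i)) }) π∈ }))
          (length-≤ (λ ω p → p ≡ (ω , ω))
            (AllPairs.map (λ { ω≢ω′ _ refl refl → ω≢ω′ refl }) unique′)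
            (All.tabulate λ {ω} ω∈ → Any.map sym
              (∈-filter⁺ both? (∈-cartesianProduct⁺ ω∈ ω∈)
                (≤ᴮ-reflexive {π = ω} {ω} (λ _ → refl) , ≤ᴮ-reflexive {π = ω} {ω} (λ _ → refl)))))
          where
          both? : Decidable (λ p → Below p × Above p)
          both? p = below? p ×-dec above? p

      length-comparable-pairs :
        length (filter (λ (π , σ) → comparable? π σ) xs²) + length (weakCompositions 4 m) ≡
        length (pairs m) + length (pairs m)
      length-comparable-pairs = trans
        (cong (length (filter (λ (π , σ) → comparable? π σ) xs²) +_)
          (trans (sym length-bigrassmannians) (sym length-both)))
        (trans (length-filter-∪∩ below? above? xs²) (cong₂ _+_ length-≤-pairs length-≥-pairs))

  -- From cardinalities to closed forms.

  length-cartesianProduct : ∀ {A B : Set} (xs : List A) (ys : List B) →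
    length (cartesianProduct xs ys) ≡ length xs * length ys
  length-cartesianProduct []       ys = refl
  length-cartesianProduct (x ∷ xs) ys = trans (length-++ (map (x ,_) ys))
    (cong₂ _+_ (length-map (x ,_) ys) (length-cartesianProduct xs ys))

  codeCount pairCount comparableCount : ℕ → ℕ
  codeCount m = length (weakCompositions 4 m)
  pairCount m = length (pairs m)
  comparableCount m = length (filter (λ (π , σ) → comparable? π σ) (cartesianProduct (𝔅 (2 + m)) (𝔅 (2 + m))))

  module _ (m : ℕ) where

    private
      n = 2 + m

      sound = All.all-filter (bigrassmannian? {n}) (permutations n)

      complete : ∀ {ω} → Bigrassmannian ω → _
      complete {ω} = 𝔅-complete {n} {ω}

    length-𝔅² : length (cartesianProduct (𝔅 n) (𝔅 n)) ≡ codeCount m * codeCount m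
    length-𝔅² = trans (length-cartesianProduct (𝔅 n) (𝔅 n)) (cong₂ _*_ length-𝔅 length-𝔅)
      where
      length-𝔅 : length (𝔅 n) ≡ codeCount m
      length-𝔅 = length-bigrassmannians (𝔅-unique n) sound (λ {ω} → complete {ω})

    p₂,≤-counts : p₂,≤ n ≡ pairCount m ÷ (codeCount m * codeCount m)
    p₂,≤-counts = cong₂ _÷_ (length-≤-pairs (𝔅-unique n) sound (λ {ω} → complete {ω})) length-𝔅²

    p₂-counts : p₂ n ≡ comparableCount m ÷ (codeCount m * codeCount m)
    p₂-counts = cong (comparableCount m ÷_) length-𝔅²

    comparableCount+codeCount : comparableCount m + codeCount m ≡ pairCount m + pairCount m
    comparableCount+codeCount = length-comparable-pairs (𝔅-unique n) sound (λ {ω} → complete {ω})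

  -- After multiplication by 360, both sides equal `10 u v (x y z)²`.
  below-algebra : ∀ T B x y z u v → 360 * T ≡ x * y * z * z * u * v → 6 * B ≡ x * y * z →
                  T * (10 * x * y) ≡ u * v * (B * B)
  below-algebra T B x y z u v T-eq B-eq = *-cancelˡ-≡ _ _ 360 (begin
    360 * (T * (10 * x * y))           ≡⟨ pull T x y ⟩
    360 * T * (10 * x * y)             ≡⟨ cong (_* (10 * x * y)) T-eq ⟩
    x * y * z * z * u * v * (10 * x * y) ≡⟨ square x y z u v ⟩
    10 * (u * v) * ((x * y * z) * (x * y * z)) ≡⟨ cong (λ X → 10 * (u * v) * (X * X)) B-eq ⟨
    10 * (u * v) * ((6 * B) * (6 * B)) ≡⟨ push u v B ⟩
    360 * (u * v * (B * B))            ∎)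
    where
    open ≡-Reasoning
    pull : ∀ T x y → 360 * (T * (10 * x * y)) ≡ 360 * T * (10 * x * y)
    pull = solve-∀
    square : ∀ x y z u v →
      x * y * z * z * u * v * (10 * x * y) ≡ 10 * (u * v) * ((x * y * z) * (x * y * z))
    square = solve-∀
    push : ∀ u v B → 10 * (u * v) * ((6 * B) * (6 * B)) ≡ 360 * (u * v * (B * B))
    push = solve-∀

  -- From `C = 2T - B` comes `180 C = x y z (z u v - 30)`. The last factor is `N`, specified by an
  -- addition so as to stay within ℕ.
  comparable-algebra : ∀ C T B x y z u v N → C + B ≡ T + T →
    360 * T ≡ x * y * z * z * u * v → 6 * B ≡ x * y * z → N + 30 ≡ z * u * v →
    C * (5 * x * y * z) ≡ N * (B * B)
  comparable-algebra C T B x y z u v N C-eq T-eq B-eq N-eq = *-cancelˡ-≡ _ _ 36 (begin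
    36 * (C * (5 * x * y * z))          ≡⟨ pull C x y z ⟩
    180 * C * (x * y * z)               ≡⟨ cong (_* (x * y * z)) scaled ⟩
    N * (x * y * z) * (x * y * z)       ≡⟨ cong (λ X → N * X * X) B-eq ⟨
    N * (6 * B) * (6 * B)               ≡⟨ push N B ⟩
    36 * (N * (B * B))                  ∎)
    where
    open ≡-Reasoning
    pull : ∀ C x y z → 36 * (C * (5 * x * y * z)) ≡ 180 * C * (x * y * z)
    pull = solve-∀
    push : ∀ N B → N * (6 * B) * (6 * B) ≡ 36 * (N * (B * B))
    push = solve-∀
    split : ∀ C B → 180 * C + 30 * (6 * B) ≡ 180 * (C + B)
    split = solve-∀
    double : ∀ T → 180 * (T + T) ≡ 360 * T
    double = solve-∀
    regroup : ∀ x y z u v → x * y * z * z * u * v ≡ x * y * z * (z * u * v)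
    regroup = solve-∀
    unsplit : ∀ X N → X * (N + 30) ≡ N * X + 30 * X
    unsplit = solve-∀
    scaled : 180 * C ≡ N * (x * y * z)
    scaled = +-cancelʳ-≡ (30 * (x * y * z)) _ _ (begin
      180 * C + 30 * (x * y * z)        ≡⟨ cong (λ X → 180 * C + 30 * X) B-eq ⟨
      180 * C + 30 * (6 * B)            ≡⟨ split C B ⟩
      180 * (C + B)                     ≡⟨ cong (180 *_) C-eq ⟩
      180 * (T + T)                     ≡⟨ double T ⟩
      360 * T                           ≡⟨ T-eq ⟩
      x * y * z * z * u * v             ≡⟨ regroup x y z u v ⟩
      x * y * z * (z * u * v)           ≡⟨ cong (x * y * z *_) N-eq ⟨
      x * y * z * (N + 30)              ≡⟨ unsplit (x * y * z) N ⟩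
      N * (x * y * z) + 30 * (x * y * z) ∎)

  comparableNumerator : ℕ → ℕ
  comparableNumerator m = m * m * m + 12 * m * m + 47 * m + 30

  comparableDenominator belowDenominator : ℕ → ℕ
  comparableDenominator m = 5 * (1 + m) * (2 + m) * (3 + m)
  belowDenominator m = 10 * (1 + m) * (2 + m)

  p₂-closed : ∀ m → p₂ (2 + m) ≡ comparableNumerator m ÷ comparableDenominator m
  p₂,≤-closed : ∀ m → p₂,≤ (2 + m) ≡ ((4 + m) * (5 + m)) ÷ belowDenominator m

  private
    codeCount²-nonZero : ∀ m → NonZero (codeCount m * codeCount m)
    codeCount²-nonZero m = m*n≢0 (codeCount m) (codeCount m)
      where instance
        codeCount-nonZero : NonZero (codeCount m)
        codeCount-nonZero = ≢-nonZero λ eq → 0≢1+n (trans (cong (6 *_) (sym eq)) (length-codes m))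

  p₂-closed m = trans (p₂-counts m) (÷-≡ (comparableCount m) (codeCount m * codeCount m)
    (comparableNumerator m) (comparableDenominator m) {{codeCount²-nonZero m}}
    (comparable-algebra (comparableCount m) (pairCount m) (codeCount m) (1 + m) (2 + m) (3 + m) (4 + m) (5 + m)
      (comparableNumerator m) (comparableCount+codeCount m) (length-pairs m) (length-codes m) (numerator m)))
    where
    numerator : ∀ m → m * m * m + 12 * m * m + 47 * m + 30 + 30 ≡ (3 + m) * (4 + m) * (5 + m)
    numerator = solve-∀

  p₂,≤-closed m = trans (p₂,≤-counts m) (÷-≡ (pairCount m) (codeCount m * codeCount m)
    ((4 + m) * (5 + m)) (belowDenominator m) {{codeCount²-nonZero m}}
    (below-algebra (pairCount m) (codeCount m) (1 + m) (2 + m) (3 + m) (4 + m) (5 + m)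
      (length-pairs m) (length-codes m)))

  private
    positive-difference : ∀ {a b} e .{{_ : NonZero e}} → a + e ≡ b → a < b
    positive-difference {a} (suc e) refl = m<m+n a (s≤s z≤n)

  comparable-decreasing : ∀ m → comparableNumerator (suc m) * comparableDenominator m <
                                comparableNumerator m * comparableDenominator (suc m)
  comparable-decreasing m =
    positive-difference (5 * (2 + m) * (3 + m) * (30 + 54 * m + 6 * m * m)) (identity m)
    where
    identity : ∀ m →
      (suc m * suc m * suc m + 12 * suc m * suc m + 47 * suc m + 30) * (5 * (1 + m) * (2 + m) * (3 + m)) +
        5 * (2 + m) * (3 + m) * (30 + 54 * m + 6 * m * m) ≡
      (m * m * m + 12 * m * m + 47 * m + 30) * (5 * (2 + m) * (3 + m) * (4 + m))
    identity = solve-∀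

  below-decreasing : ∀ m →
    (5 + m) * (6 + m) * belowDenominator m < (4 + m) * (5 + m) * belowDenominator (suc m)
  below-decreasing m = positive-difference (60 * (5 + m) * (2 + m)) (identity m)
    where
    identity : ∀ m → (5 + m) * (6 + m) * (10 * (1 + m) * (2 + m)) + 60 * (5 + m) * (2 + m) ≡
                     (4 + m) * (5 + m) * (10 * (2 + m) * (3 + m))
    identity = solve-∀

  -- The numerators of `p₂ - 1/5` and `p₂,≤ - 1/10` over the denominators above. Their degree is one
  -- lower, so the excess decays like `1 / m`.
  comparableExcess belowExcess : ℕ → ℕ
  comparableExcess m = 6 * m * m + 36 * m + 24
  belowExcess m = 6 * m + 18

  comparable-limit : ∀ m →
    (m * m * m + 12 * m * m + 47 * m + 30) * (5 * (5 * (1 + m) * (2 + m) * (3 + m))) ≡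
    (1 * (5 * (1 + m) * (2 + m) * (3 + m)) + (6 * m * m + 36 * m + 24) * 5) * (5 * (1 + m) * (2 + m) * (3 + m))
  comparable-limit = solve-∀

  below-limit : ∀ m → (4 + m) * (5 + m) * (10 * (10 * (1 + m) * (2 + m))) ≡
    (1 * (10 * (1 + m) * (2 + m)) + (6 * m + 18) * 10) * (10 * (1 + m) * (2 + m))
  below-limit = solve-∀

  comparableExcess-small : ∀ m → comparableExcess m * suc m ≤ 2 * comparableDenominator m
  comparableExcess-small m = m+n≤o⇒m≤o _ (≤-reflexive (identity m))
    where
    identity : ∀ m → (6 * m * m + 36 * m + 24) * suc m + (4 * m * m + 14 * m + 36) * suc m ≡
                     2 * (5 * (1 + m) * (2 + m) * (3 + m))
    identity = solve-∀

  belowExcess-small : ∀ m → belowExcess m * suc m ≤ 1 * belowDenominator m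
  belowExcess-small m = m+n≤o⇒m≤o _ (≤-reflexive (identity m))
    where
    identity : ∀ m → (6 * m + 18) * suc m + (4 * m + 2) * suc m ≡ 1 * (10 * (1 + m) * (2 + m))
    identity = solve-∀

  -- With `n = 2 + m` this is `12 n - 18`. The term of index `k` is `(12 n - 18) / (5 n^(2k+1))`,
  -- and summation over `k ≥ 1` gives `(12 n - 18) / (5 n (n² - 1))`, whose denominator is
  -- `comparableDenominator m`.
  tailNumerator : ℕ → ℕ
  tailNumerator m = 12 * m + 6

  -- With `P = n^(2k)`, the cross-multiplied form of `12/(5 n² P) = 18/(5 n³ P) + (12 n - 18)/(5 n³
  -- P)`, which turns the difference in the series into a sum.
  comparable-term-split : ∀ m P →
    12 * (5 * ((2 + m) * ((2 + m) * ((2 + m) * P))) * (5 * ((2 + m) * ((2 + m) * ((2 + m) * P))))) ≡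
    (18 * (5 * ((2 + m) * ((2 + m) * ((2 + m) * P)))) +
      (12 * m + 6) * (5 * ((2 + m) * ((2 + m) * ((2 + m) * P))))) * (5 * ((2 + m) * ((2 + m) * P)))
  comparable-term-split = solve-∀

  -- With `D = 5 n (n² - 1)` this is `1/(5 n³) + 1/(D n²) = 1/D`, scaled by `c / P` and
  -- cross-multiplied.
  comparable-tail-step : ∀ m c P →
    (c * (5 * (1 + m) * (2 + m) * (3 + m) * ((2 + m) * ((2 + m) * P))) +
      c * (5 * ((2 + m) * ((2 + m) * ((2 + m) * P))))) * (5 * (1 + m) * (2 + m) * (3 + m) * P) ≡
    c * (5 * ((2 + m) * ((2 + m) * ((2 + m) * P))) *
      (5 * (1 + m) * (2 + m) * (3 + m) * ((2 + m) * ((2 + m) * P))))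
  comparable-tail-step = solve-∀

  below-tail-step : ∀ m P →
    (6 * (5 * (1 + m) * (2 + m) * ((2 + m) * P)) + 6 * (5 * ((2 + m) * ((2 + m) * P)))) *
      (5 * (1 + m) * (2 + m) * P) ≡
    6 * (5 * ((2 + m) * ((2 + m) * P)) * (5 * (1 + m) * (2 + m) * ((2 + m) * P)))
  below-tail-step = solve-∀

  comparable-sum : ∀ m →
    (m * m * m + 12 * m * m + 47 * m + 30) * (5 * (5 * ((2 + m) * 1)) * (5 * (1 + m) * (2 + m) * (3 + m) * 1)) ≡
    ((1 * (5 * ((2 + m) * 1)) + 6 * 5) * (5 * (1 + m) * (2 + m) * (3 + m) * 1) +
      (12 * m + 6) * (5 * (5 * ((2 + m) * 1)))) * (5 * (1 + m) * (2 + m) * (3 + m))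
  comparable-sum = solve-∀

  below-sum : ∀ m →
    (4 + m) * (5 + m) * (10 * (5 * ((2 + m) * 1)) * (5 * (1 + m) * (2 + m) * 1)) ≡
    ((1 * (5 * ((2 + m) * 1)) + 3 * 10) * (5 * (1 + m) * (2 + m) * 1) + 6 * (10 * (5 * ((2 + m) * 1)))) *
      (10 * (1 + m) * (2 + m))
  below-sum = solve-∀

  -- Linear growth of the powers is all that `÷-vanishes` asks of the remainders.
  exponential-bound : ∀ m k → suc k ≤ (2 + m) ^ k
  exponential-bound m zero    = ≤-refl
  exponential-bound m (suc k) = begin
    suc (suc k)       ≤⟨ s≤s (m≤n+m (suc k) k) ⟩
    suc k + suc k     ≤⟨ +-mono-≤ (exponential-bound m k)
                           (≤-trans (exponential-bound m k) (m≤m+n _ _)) ⟩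
    (2 + m) ^ suc k   ∎
    where open ≤-Reasoning

-- Closed forms and the two series

open import Data.Integer.Base using (+_)
open import Data.Rational.Base using (_+_; _-_)

module _ where
  open import Data.Nat.Base using (NonZero)
  import Data.Nat.Properties as ℕ
  open import Data.Rational.Base using (ℚ; -_; _<_)
  import Data.Rational.Properties as ℚ

  /5·-÷ : ∀ a n k .{{_ : NonTrivial n}} → a /5· n ^ k ≡ a ÷ (5 ℕ.* n ℕ.^ k)
  /5·-÷ a n k = /≡÷ a (5 ℕ.* n ℕ.^ k)
    where instance
      nᵏ≢0 : NonZero (n ℕ.^ k)
      nᵏ≢0 = ℕ.m^n≢0 n k {{ℕ.nonTrivial⇒nonZero n}}

      5nᵏ≢0 : NonZero (5 ℕ.* n ℕ.^ k)
      5nᵏ≢0 = ℕ.m*n≢0 5 (n ℕ.^ k)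

  difference : ∀ {x} y {z} → x ≡ y + z → x - y ≡ z
  difference y {z} refl = begin
    y + z - y     ≡⟨ cong (_- y) (ℚ.+-comm y z) ⟩
    z + y - y     ≡⟨ ℚ.+-assoc z y (- y) ⟩
    z + (y - y)   ≡⟨ cong (_+_ z) (ℚ.+-inverseʳ y) ⟩
    z + + 0 / 1   ≡⟨ ℚ.+-identityʳ z ⟩
    z             ∎
    where open ≡-Reasoning

  module _ (m : ℕ) where

    private
      n = 2 ℕ.+ m
      c = tailNumerator m
      D = comparableDenominator m
      E = 5 ℕ.* (1 ℕ.+ m) ℕ.* (2 ℕ.+ m)

      comparable-step : ∀ P .{{_ : NonZero P}} →
        12 ÷ (5 ℕ.* (n ℕ.* (n ℕ.* P))) - 18 ÷ (5 ℕ.* (n ℕ.* (n ℕ.* (n ℕ.* P)))) + c ÷ (D ℕ.* (n ℕ.* (n ℕ.* P))) ≡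
        c ÷ (D ℕ.* P)
      comparable-step (suc P) = trans
        (cong (_+ c ÷ S) (difference (18 ÷ R) {c ÷ R} (trans
          (÷-≡ 12 Q (18 ℕ.* R ℕ.+ c ℕ.* R) (R ℕ.* R) (comparable-term-split m (suc P)))
          (sym (÷-+ 18 R c R)))))
        (trans (÷-+ c R c S)
          (÷-≡ (c ℕ.* S ℕ.+ c ℕ.* R) (R ℕ.* S) c (D ℕ.* suc P) (comparable-tail-step m c (suc P))))
        where
        Q = 5 ℕ.* (n ℕ.* (n ℕ.* suc P))
        R = 5 ℕ.* (n ℕ.* (n ℕ.* (n ℕ.* suc P)))
        S = D ℕ.* (n ℕ.* (n ℕ.* suc P))

      below-step : ∀ P .{{_ : NonZero P}} →
        6 ÷ (5 ℕ.* (n ℕ.* (n ℕ.* P))) + 6 ÷ (E ℕ.* (n ℕ.* P)) ≡ 6 ÷ (E ℕ.* P)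
      below-step (suc P) = trans (÷-+ 6 R 6 S)
        (÷-≡ (6 ℕ.* S ℕ.+ 6 ℕ.* R) (R ℕ.* S) 6 (E ℕ.* suc P) (below-tail-step m (suc P)))
        where
        R = 5 ℕ.* (n ℕ.* (n ℕ.* suc P))
        S = E ℕ.* (n ℕ.* suc P)

    -- The geometric remainders after `k` terms; at `k = 0` they are the sums of the two series.
    -- Here `D = 5 n (n² - 1)` and `E = 5 n (n - 1)`.
    comparableTail belowTail : ℕ → ℚ
    comparableTail k = c ÷ (D ℕ.* n ℕ.^ (2 ℕ.* k))
    belowTail k = 6 ÷ (E ℕ.* n ℕ.^ k)

    comparable-series : HasSumFrom 1 (λ k → 12 /5· n ^ (2 ℕ.* k) - 18 /5· n ^ (2 ℕ.* k ℕ.+ 1)) (comparableTail 0)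
    comparable-series = telescoping 1 {t = comparableTail}
      (÷-vanishes (λ _ → c) (λ k → D ℕ.* n ℕ.^ (2 ℕ.* k)) c (λ k → ℕ.*-monoʳ-≤ c (ℕ.≤-trans
        (ℕ.≤-trans (ℕ.s≤s (ℕ.m≤m+n k (k ℕ.+ 0))) (exponential-bound m (2 ℕ.* k))) (ℕ.m≤n*m _ D))))
      step
      where
      step : ∀ k →
        12 /5· n ^ (2 ℕ.* suc k) - 18 /5· n ^ (2 ℕ.* suc k ℕ.+ 1) + comparableTail (suc k) ≡
                   comparableTail k
      step k = begin
        12 /5· n ^ (2 ℕ.* suc k) - 18 /5· n ^ (2 ℕ.* suc k ℕ.+ 1) + comparableTail (suc k)
          ≡⟨ cong (_+ comparableTail (suc k)) (cong₂ _-_ (/5·-÷ 12 n (2 ℕ.* suc k)) (/5·-÷ 18 n (2 ℕ.* suc k ℕ.+ 1))) ⟩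
        12 ÷ (5 ℕ.* n ℕ.^ (2 ℕ.* suc k)) - 18 ÷ (5 ℕ.* n ℕ.^ (2 ℕ.* suc k ℕ.+ 1)) + comparableTail (suc k)
          ≡⟨ cong₂ (λ i j → 12 ÷ (5 ℕ.* n ℕ.^ i) - 18 ÷ (5 ℕ.* n ℕ.^ j) + c ÷ (D ℕ.* n ℕ.^ i))
               (ℕ.*-suc 2 k) (trans (ℕ.+-comm (2 ℕ.* suc k) 1) (cong suc (ℕ.*-suc 2 k))) ⟩
        12 ÷ (5 ℕ.* (n ℕ.* (n ℕ.* P))) - 18 ÷ (5 ℕ.* (n ℕ.* (n ℕ.* (n ℕ.* P)))) + c ÷ (D ℕ.* (n ℕ.* (n ℕ.* P)))
          ≡⟨ comparable-step P {{ℕ.m^n≢0 n (2 ℕ.* k)}} ⟩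
        comparableTail k ∎
        where
        open ≡-Reasoning
        P = n ℕ.^ (2 ℕ.* k)

    below-series : HasSumFrom 2 (λ k → 6 /5· n ^ k) (belowTail 0)
    below-series = telescoping 2 {t = belowTail}
      (÷-vanishes (λ _ → 6) (λ k → E ℕ.* n ℕ.^ k) 6
        (λ k → ℕ.*-monoʳ-≤ 6 (ℕ.≤-trans (exponential-bound m k) (ℕ.m≤n*m _ E))))
      (λ k → trans (cong (_+ belowTail (suc k)) (/5·-÷ 6 n (2 ℕ.+ k)))
        (below-step (n ℕ.^ k) {{ℕ.m^n≢0 n k}}))

    comparable-value : p₂ n ≡ + 1 / 5 + 6 /5· n ^ 1 + comparableTail 0
    comparable-value = trans (p₂-closed m) (sym (begin
      1 ÷ 5 + 6 /5· n ^ 1 + c ÷ (D ℕ.* 1)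
        ≡⟨ cong (λ x → 1 ÷ 5 + x + c ÷ (D ℕ.* 1)) (/5·-÷ 6 n 1) ⟩
      1 ÷ 5 + 6 ÷ (5 ℕ.* (n ℕ.* 1)) + c ÷ (D ℕ.* 1)
        ≡⟨ cong (_+ c ÷ (D ℕ.* 1)) (÷-+ 1 5 6 (5 ℕ.* (n ℕ.* 1))) ⟩
      num ÷ den + c ÷ (D ℕ.* 1)
        ≡⟨ ÷-+ num den c (D ℕ.* 1) ⟩
      (num ℕ.* (D ℕ.* 1) ℕ.+ c ℕ.* den) ÷ (den ℕ.* (D ℕ.* 1))
        ≡⟨ ÷-≡ (comparableNumerator m) D (num ℕ.* (D ℕ.* 1) ℕ.+ c ℕ.* den) (den ℕ.* (D ℕ.* 1)) (comparable-sum m) ⟨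
      comparableNumerator m ÷ D ∎))
      where
      open ≡-Reasoning
      num = 1 ℕ.* (5 ℕ.* (n ℕ.* 1)) ℕ.+ 6 ℕ.* 5
      den = 5 ℕ.* (5 ℕ.* (n ℕ.* 1))

    below-value : p₂,≤ n ≡ + 1 / 10 + 3 /5· n ^ 1 + belowTail 0
    below-value = trans (p₂,≤-closed m) (sym (begin
      1 ÷ 10 + 3 /5· n ^ 1 + 6 ÷ (E ℕ.* 1)
        ≡⟨ cong (λ x → 1 ÷ 10 + x + 6 ÷ (E ℕ.* 1)) (/5·-÷ 3 n 1) ⟩
      1 ÷ 10 + 3 ÷ (5 ℕ.* (n ℕ.* 1)) + 6 ÷ (E ℕ.* 1)
        ≡⟨ cong (_+ 6 ÷ (E ℕ.* 1)) (÷-+ 1 10 3 (5 ℕ.* (n ℕ.* 1))) ⟩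
      num ÷ den + 6 ÷ (E ℕ.* 1)
        ≡⟨ ÷-+ num den 6 (E ℕ.* 1) ⟩
      (num ℕ.* (E ℕ.* 1) ℕ.+ 6 ℕ.* den) ÷ (den ℕ.* (E ℕ.* 1))
        ≡⟨ ÷-≡ ((4 ℕ.+ m) ℕ.* (5 ℕ.+ m)) (belowDenominator m)
             (num ℕ.* (E ℕ.* 1) ℕ.+ 6 ℕ.* den) (den ℕ.* (E ℕ.* 1)) (below-sum m) ⟨
      ((4 ℕ.+ m) ℕ.* (5 ℕ.+ m)) ÷ belowDenominator m ∎))
      where
      open ≡-Reasoning
      num = 1 ℕ.* (5 ℕ.* (n ℕ.* 1)) ℕ.+ 3 ℕ.* 10
      den = 10 ℕ.* (5 ℕ.* (n ℕ.* 1))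

  p₂-decreasing : ∀ n .{{_ : NonTrivial n}} → p₂ (suc n) < p₂ n
  p₂-decreasing (suc (suc m)) = subst₂ _<_ (sym (p₂-closed (suc m))) (sym (p₂-closed m))
    (÷-< (comparableNumerator (suc m)) (comparableDenominator (suc m))
         (comparableNumerator m) (comparableDenominator m) (comparable-decreasing m))

  p₂,≤-decreasing : ∀ n .{{_ : NonTrivial n}} → p₂,≤ (suc n) < p₂,≤ n
  p₂,≤-decreasing (suc (suc m)) = subst₂ _<_ (sym (p₂,≤-closed (suc m))) (sym (p₂,≤-closed m))
    (÷-< ((5 ℕ.+ m) ℕ.* (6 ℕ.+ m)) (belowDenominator (suc m))
         ((4 ℕ.+ m) ℕ.* (5 ℕ.+ m)) (belowDenominator m) (below-decreasing m))

  p₂-limit : p₂ ⟶∞ + 1 / 5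
  p₂-limit = ⟶∞-above 2 {p₂} {λ m → comparableExcess m ÷ comparableDenominator m} {+ 1 / 5}
    (÷-vanishes comparableExcess comparableDenominator 2 comparableExcess-small) λ m →
    let D = comparableDenominator m ; r = comparableExcess m in
    trans (p₂-closed m) (trans
      (÷-≡ (comparableNumerator m) D (1 ℕ.* D ℕ.+ r ℕ.* 5) (5 ℕ.* D) (comparable-limit m))
      (sym (÷-+ 1 5 r D)))

  p₂,≤-limit : p₂,≤ ⟶∞ + 1 / 10
  p₂,≤-limit = ⟶∞-above 2 {p₂,≤} {λ m → belowExcess m ÷ belowDenominator m} {+ 1 / 10}
    (÷-vanishes belowExcess belowDenominator 1 belowExcess-small) λ m →
    let D = belowDenominator m ; r = belowExcess m in
    trans (p₂,≤-closed m) (trans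
      (÷-≡ ((4 ℕ.+ m) ℕ.* (5 ℕ.+ m)) D (1 ℕ.* D ℕ.+ r ℕ.* 10) (10 ℕ.* D) (below-limit m))
      (sym (÷-+ 1 10 r D)))

corollary5p3 : (∀ n → .{{_ : NonTrivial n}} →
    (∃ λ s → HasSumFrom 1 (λ k → 12 /5· n ^ (2 ℕ.* k) - 18 /5· n ^ (2 ℕ.* k ℕ.+ 1)) s
    × p₂ n ≡ + 1 / 5 + 6 /5· n ^ 1 + s)
    ×
    (∃ λ s → HasSumFrom 2 (λ k → 6 /5· n ^ k) s
    × p₂,≤ n ≡ + 1 / 10 + 3 /5· n ^ 1 + s))
    × p₂ ↓ + 1 / 5
    × p₂,≤ ↓ + 1 / 10
corollary5p3 =
  (λ { (suc (suc m)) → (comparableTail m 0 , comparable-series m , comparable-value m) ,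
                       (belowTail m 0 , below-series m , below-value m) }) ,
  (p₂-decreasing , p₂-limit) ,
  (p₂,≤-decreasing , p₂,≤-limit)
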